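{- There exist absolute constants $C>c>0$ such that the following holds. Let $H$ be an $n$-vertex $d$-regular graph. (1) If $\chi(H)=2$, then $n^{cd}\le ER(H)\le n^{Cd}$. (2) If $\chi:=\chi(H)\ge 3$, then $2^{cn}\le ER(H)\le n^{Cd\chi n}$.
   Context: Edge-colorings of the complete graph $K_N$ may use an arbitrary number of colors. A copy of a graph $H$ in $K_N$ is given by an injective map $\varphi:V(H)\to V(K_N)$, its edges being $\varphi(u)\varphi(v)$ for $uv\in E(H)$. The copy is canonically colored if it is (a) monochromatic (all its edges have the same color), (b) rainbow (all its edges have distinct colors), or (c) lexicographic: there is an ordering $v_1,\dots,v_n$ of $V(H)$ such that for every $i$, all edges $\varphi(v_i)\varphi(v_j)$ with $v_iv_j\in E(H)$ and $j>i$ have the same color $c_i$, and these colors are distinct for different vertices $v_i$. The Erdős–Rado number $ER(H)$ is the smallest $N$ such that every edge-coloring of $K_N$ contains a canonically colored copy of $H$. $\chi(H)$ denotes the chromatic number. -}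

module Defs where

open import Data.Nat using (ℕ; _<_; _+_)
open import Data.Bool using (Bool; true; false; if_then_else_)
open import Data.Fin using (Fin; toℕ)
open import Data.List using (map; allFin)
open import Data.Nat.ListAction using (sum)
open import Data.Product using (Σ; ∃; _×_; _,_)
open import Data.Sum using (_⊎_)
open import Relation.Binary.PropositionalEquality using (_≡_)
open import Relation.Nullary using (¬_)
open import Function.Definitions using (Injective)

record Graph (n : ℕ) : Set where
  field
    adj     : Fin n → Fin n → Bool
    sym     : ∀ u v → adj u v ≡ adj v u
    irrefl  : ∀ v → adj v v ≡ false
open Graph public

Edge : ∀ {n} → Graph n → Fin n → Fin n → Set
Edge H u v = adj H u v ≡ true

degree : ∀ {n} → Graph n → Fin n → ℕ
degree {n} H v = sum (map (λ u → if adj H v u then 1 else 0) (allFin n))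

Regular : ∀ {n} → Graph n → ℕ → Set
Regular {n} H d = ∀ (v : Fin n) → degree H v ≡ d

Colorable : ∀ {n} → Graph n → ℕ → Set
Colorable {n} H k = Σ (Fin n → Fin k) λ f → ∀ u v → Edge H u v → ¬ (f u ≡ f v)

IsChromatic : ∀ {n} → Graph n → ℕ → Set
IsChromatic H k = Colorable H k × (∀ j → j < k → ¬ Colorable H j)

-- Edge-colourings of K_N with arbitrarily many colours (colours in ℕ);
-- the colour of edge {i,j} (i ≠ j) is c i j, with c symmetric.
SymColoring : ℕ → Set
SymColoring N = Σ (Fin N → Fin N → ℕ) λ c → ∀ i j → c i j ≡ c j i

module _ {n N : ℕ} (H : Graph n) (c : Fin N → Fin N → ℕ) (φ : Fin n → Fin N) where

  ecol : Fin n → Fin n → ℕ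
  ecol u v = c (φ u) (φ v)

  Monochromatic : Set
  Monochromatic = ∃ λ col → ∀ u v → Edge H u v → ecol u v ≡ col

  Rainbow : Set
  Rainbow = ∀ u v u' v' → Edge H u v → Edge H u' v' → ecol u v ≡ ecol u' v' →
              (u ≡ u' × v ≡ v') ⊎ (u ≡ v' × v ≡ u')

  -- ordering given by an injective position map pos : Fin n → Fin n
  -- (v_i is the vertex with pos v_i = i); colours c_i given by col, distinct.
  Lexicographic : Set
  Lexicographic = Σ (Fin n → Fin n) λ pos → Injective _≡_ _≡_ pos ×
                  Σ (Fin n → ℕ) λ col → Injective _≡_ _≡_ col ×
                  (∀ u w → Edge H u w → toℕ (pos u) < toℕ (pos w) → ecol u w ≡ col u)

  Canonical : Set
  Canonical = Monochromatic ⊎ (Rainbow ⊎ Lexicographic)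

Arrows : ∀ {n} → ℕ → Graph n → Set
Arrows {n} N H = ∀ (c : SymColoring N) →
  Σ (Fin n → Fin N) λ φ → Injective _≡_ _≡_ φ × Canonical H (Data.Product.proj₁ c) φ

IsER : ∀ {n} → Graph n → ℕ → Set
IsER H E = Arrows E H × (∀ M → M < E → ¬ Arrows M H)

{-# OPTIONS --safe #-}

-- Upper bounds. Call v ∈ S popular if at least |S| / q of the edges from v into S share a colour κ(v), where q is a
-- power of n. If at least half of S is unpopular, a random n-tuple of unpopular vertices spans a rainbow K_n.
-- Otherwise dependent random choice yields a large set A of popular vertices every d of which have more than
-- 2n common "neighbours" in S, where w is a neighbour of v if c(v, w) = κ(v). If H is bipartite, one side is embedded
-- into n vertices of A on which κ is constant (giving a monochromatic copy) or injective (giving a lexicographic copy),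
-- the other side greedily into S. In general one shrinks S repeatedly: if a popular vertex has a new colour κ(v),
-- pass to its neighbourhood in that colour, and n such steps give a lexicographic K_n; otherwise some old colour κ
-- occurs often, and dependent random choice in colour κ adds a storey to the tower of sets of that colour. A tower of
-- χ(H) − 1 storeys contains a monochromatic copy of H, one colour class per set, so at most χ(H) n steps are made,
-- each of which divides |S| by n^{O(d)}.
--
-- Lower bounds. An independent set in a regular graph has at most n/2 vertices, so rainbow and lexicographic copies use
-- at least n/2 colours. With fewer colours only monochromatic copies need to be avoided: for non-bipartite H colour
-- the edges of K_{2^r} by the first binary digit in which the endpoints differ, so that every colour class is bipartite;
-- for bipartite H use a random colouring with r ≈ n/2 colours on r^{⌊(d−1)/2⌋} vertices.

module Submission where

open import Defs renaming (sym to adj-sym)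
import Data.Bool as Bool
open Bool using (true; false; if_then_else_)
open import Data.Empty using (⊥-elim)
open import Data.Fin using (Fin; zero; suc; toℕ; fromℕ<; opposite; inject≤; combine; remQuot; finToFun; funToFin)
import Data.Fin.Properties as Fin
open import Data.List using (List; []; _∷_; _++_; map; length; filter; concatMap; allFin; lookup; cartesianProduct)
open import Data.List.Membership.Propositional using (_∈_; _∉_; find; lose)
open import Data.List.Membership.Propositional.Properties
  using (∈-map⁺; ∈-map⁻; ∈-concatMap⁺; ∈-concatMap⁻; ∈-filter⁺; ∈-filter⁻; ∈-allFin; ∈-length; ∈-lookup; ∈-cartesianProduct⁺)
open import Data.List.Properties using (map-∘; map-cong; map-++; length-filter; length-map; length-tabulate; filter-notAll)
open import Data.List.Relation.Binary.Subset.Propositional using (_⊆_)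
open import Data.List.Relation.Unary.All as All using (All; []; _∷_)
open import Data.List.Relation.Unary.AllPairs using (AllPairs; []; _∷_)
open import Data.List.Relation.Unary.Any as Any using (Any; here; there)
open import Data.List.Relation.Unary.Unique.Propositional using (Unique)
open import Data.List.Relation.Unary.Unique.Propositional.Properties using (filter⁺; allFin⁺; map⁺; cartesianProduct⁺)
open import Data.Nat using (ℕ; zero; suc; _+_; _*_; _^_; _≤_; _<_; z≤n; s≤s; NonZero; >-nonZero; _≟_; _≤?_; _<?_)
open import Data.Nat.ListAction using (sum)
open import Data.Nat.ListAction.Properties using (sum-++)
open import Data.Nat.Properties hiding (_≟_; _≤?_; _<?_)
import Data.Nat.Properties as ℕ
open import Algebra.Properties.CommutativeSemigroup +-commutativeSemigroup using (interchange)
open import Algebra.Properties.CommutativeSemigroup *-commutativeSemigroup using () renaming (x∙yz≈y∙xz to *-left-comm)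
open import Data.Product using (∃; _×_; _,_; proj₁; proj₂; uncurry)
open import Data.Sum using (_⊎_; inj₁; inj₂; [_,_]′; map₂)
open import Data.Vec using (Vec; []; _∷_; _[_]≔_; fromList) renaming (lookup to lookupᵛ; tabulate to tabulateᵛ)
open import Data.Vec.Properties using (lookup∘tabulate; lookup∘update; lookup∘update′)
open import Data.Vec.Relation.Unary.All as VAll using ([]; _∷_)
import Data.Vec.Relation.Unary.All.Properties as VAll
open import Function using (_∘_; id)
open import Function.Definitions using (Injective)
open import Relation.Binary using (DecidableEquality; tri<; tri≈; tri>)
open import Relation.Binary.PropositionalEquality
open import Relation.Nullary using (¬_; Dec; yes; no; does; _×-dec_; _→-dec_; _⊎-dec_; ¬?; map′)
open import Relation.Nullary.Decidable using (decidable-stable)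
open import Relation.Unary using (Decidable)

private variable
  A B : Set

-- Finite sums and counting

∑ : List A → (A → ℕ) → ℕ
∑ xs f = sum (map f xs)

syntax ∑ xs (λ x → e) = ∑[ x ∈ xs ] e

𝟙 : {P : Set} → Dec P → ℕ
𝟙 d = if does d then 1 else 0

# : {P : A → Set} → Decidable P → List A → ℕ
# P? xs = length (filter P? xs)

𝟙-yes : {P : Set} (d : Dec P) → P → 𝟙 d ≡ 1
𝟙-yes (yes _) _ = refl
𝟙-yes (no ¬p) p = ⊥-elim (¬p p)

𝟙-no : {P : Set} (d : Dec P) → ¬ P → 𝟙 d ≡ 0
𝟙-no (yes p) ¬p = ⊥-elim (¬p p)
𝟙-no (no _) _ = refl

𝟙-mono : {P Q : Set} (d : Dec P) (e : Dec Q) → (P → Q) → 𝟙 d ≤ 𝟙 e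
𝟙-mono (yes p) e f = ≤-reflexive (sym (𝟙-yes e (f p)))
𝟙-mono (no _) e f = z≤n

∑-cong : (xs : List A) {f g : A → ℕ} → (∀ x → f x ≡ g x) → ∑ xs f ≡ ∑ xs g
∑-cong xs h = cong sum (map-cong h xs)

∑-mono : (xs : List A) {f g : A → ℕ} → (∀ {x} → x ∈ xs → f x ≤ g x) → ∑ xs f ≤ ∑ xs g
∑-mono [] h = z≤n
∑-mono (x ∷ xs) h = +-mono-≤ (h (here refl)) (∑-mono xs (h ∘ there))

∑-const : (xs : List A) (k : ℕ) → ∑ xs (λ _ → k) ≡ length xs * k
∑-const [] k = refl
∑-const (x ∷ xs) k = cong (k +_) (∑-const xs k)

∑-+ : (xs : List A) (f g : A → ℕ) → ∑ xs (λ x → f x + g x) ≡ ∑ xs f + ∑ xs g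
∑-+ [] f g = refl
∑-+ (x ∷ xs) f g = trans (cong (f x + g x +_) (∑-+ xs f g)) (interchange (f x) (g x) (∑ xs f) (∑ xs g))

∑-*ˡ : (k : ℕ) (xs : List A) (f : A → ℕ) → ∑ xs (λ x → k * f x) ≡ k * ∑ xs f
∑-*ˡ k [] f = sym (*-zeroʳ k)
∑-*ˡ k (x ∷ xs) f = trans (cong (k * f x +_) (∑-*ˡ k xs f)) (sym (*-distribˡ-+ k (f x) (∑ xs f)))

∑-swap : (xs : List A) (ys : List B) (f : A → B → ℕ) →
  ∑[ x ∈ xs ] ∑[ y ∈ ys ] f x y ≡ ∑[ y ∈ ys ] ∑[ x ∈ xs ] f x y
∑-swap [] ys f = sym (trans (∑-const ys 0) (*-zeroʳ (length ys)))
∑-swap (x ∷ xs) ys f =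
  trans (cong (∑ ys (f x) +_) (∑-swap xs ys f)) (sym (∑-+ ys (f x) (λ y → ∑[ z ∈ xs ] f z y)))

∑-map : (g : A → B) (xs : List A) (f : B → ℕ) → ∑ (map g xs) f ≡ ∑ xs (f ∘ g)
∑-map g xs f = cong sum (sym (map-∘ xs))

∑-++ : (xs ys : List A) (f : A → ℕ) → ∑ (xs ++ ys) f ≡ ∑ xs f + ∑ ys f
∑-++ xs ys f = trans (cong sum (map-++ f xs ys)) (sum-++ (map f xs) (map f ys))

∑-concatMap : (g : A → List B) (xs : List A) (f : B → ℕ) →
  ∑ (concatMap g xs) f ≡ ∑[ x ∈ xs ] ∑ (g x) f
∑-concatMap g [] f = refl
∑-concatMap g (x ∷ xs) f = trans (∑-++ (g x) (concatMap g xs) f) (cong (∑ (g x) f +_) (∑-concatMap g xs f))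

∑-<-∃ : (xs : List A) (f g : A → ℕ) → ∑ xs f < ∑ xs g → ∃ λ x → x ∈ xs × f x < g x
∑-<-∃ (x ∷ xs) f g lt with f x <? g x
... | yes p = x , here refl , p
... | no ¬p with ∑-<-∃ xs f g (+-cancelˡ-< (g x) _ _ (≤-<-trans (+-monoˡ-≤ (∑ xs f) (≮⇒≥ ¬p)) lt))
...   | y , y∈ , q = y , there y∈ , q

#-∑ : {P : A → Set} (P? : Decidable P) (xs : List A) → # P? xs ≡ ∑ xs (𝟙 ∘ P?)
#-∑ P? [] = refl
#-∑ P? (x ∷ xs) with P? x
... | yes _ = cong suc (#-∑ P? xs)
... | no _  = #-∑ P? xs

#-mono : {P Q : A → Set} (P? : Decidable P) (Q? : Decidable Q) (xs : List A) →
  (∀ {x} → x ∈ xs → P x → Q x) → # P? xs ≤ # Q? xs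
#-mono P? Q? xs h = begin
  # P? xs        ≡⟨ #-∑ P? xs ⟩
  ∑ xs (𝟙 ∘ P?) ≤⟨ ∑-mono xs (λ {x} x∈ → 𝟙-mono (P? x) (Q? x) (h x∈)) ⟩
  ∑ xs (𝟙 ∘ Q?) ≡⟨ #-∑ Q? xs ⟨
  # Q? xs        ∎
  where open ≤-Reasoning

#-complement : {P : A → Set} (P? : Decidable P) (xs : List A) → # P? xs + # (¬? ∘ P?) xs ≡ length xs
#-complement P? [] = refl
#-complement P? (x ∷ xs) with P? x
... | yes _ = cong suc (#-complement P? xs)
... | no _  = trans (+-suc _ _) (cong suc (#-complement P? xs))

-- Fewer than `q` events, each of probability at most 1/q. Counting the pairs of an event and an
-- outcome in it, the average number of events per outcome is below 1, so some outcome lies in none.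
union-bound : {X E : Set} {Ev : E → X → Set} (ev? : ∀ e x → Dec (Ev e x)) (xs : List X) (es : List E) (q : ℕ) →
  (∀ {e} → e ∈ es → q * # (ev? e) xs ≤ length xs) → length es < q → 0 < length xs →
  ∃ λ x → x ∈ xs × (∀ {e} → e ∈ es → ¬ Ev e x)
union-bound ev? xs es q h es<q 0<xs
  with ∑-<-∃ xs (λ x → ∑[ e ∈ es ] 𝟙 (ev? e x)) (λ _ → 1) (*-cancelˡ-< q _ _ bound)
  where
  open ≤-Reasoning
  bound : q * ∑[ x ∈ xs ] ∑[ e ∈ es ] 𝟙 (ev? e x) < q * ∑[ _ ∈ xs ] 1
  bound = begin-strict
    q * ∑[ x ∈ xs ] ∑[ e ∈ es ] 𝟙 (ev? e x)   ≡⟨ cong (q *_) (∑-swap xs es _) ⟩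
    q * ∑[ e ∈ es ] ∑[ x ∈ xs ] 𝟙 (ev? e x)   ≡⟨ ∑-*ˡ q es _ ⟨
    ∑[ e ∈ es ] (q * ∑[ x ∈ xs ] 𝟙 (ev? e x)) ≡⟨ ∑-cong es (λ e → cong (q *_) (sym (#-∑ (ev? e) xs))) ⟩
    ∑[ e ∈ es ] (q * # (ev? e) xs)            ≤⟨ ∑-mono es h ⟩
    ∑[ e ∈ es ] length xs                     ≡⟨ ∑-const es (length xs) ⟩
    length es * length xs                     <⟨ *-monoˡ-< (length xs) {{>-nonZero 0<xs}} es<q ⟩
    q * length xs                             ≡⟨ cong (q *_) (trans (∑-const xs 1) (*-identityʳ _)) ⟨
    q * ∑[ _ ∈ xs ] 1                         ∎
... | x , x∈ , lt = x , x∈ , λ e∈ ev → <⇒≱ lt (pos es e∈ ev)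
  where
  pos : ∀ es {e} → e ∈ es → _ → 1 ≤ ∑[ e ∈ es ] 𝟙 (ev? e x)
  pos (e ∷ es) (here refl) ev = ≤-trans (≤-reflexive (sym (𝟙-yes (ev? e x) ev))) (m≤m+n _ _)
  pos (e ∷ es) (there e∈) ev = ≤-trans (pos es e∈ ev) (m≤n+m _ _)

-- The sample space of `n` independent uniform choices from a list; probabilities are expressed by
-- counting in it.
vecs : ∀ n → List A → List (Vec A n)
vecs zero xs = [] ∷ []
vecs (suc n) xs = concatMap (λ x → map (x ∷_) (vecs n xs)) xs

∑-vecs : ∀ n (xs : List A) (F : Vec A (suc n) → ℕ) →
  ∑ (vecs (suc n) xs) F ≡ ∑[ x ∈ xs ] ∑[ v ∈ vecs n xs ] F (x ∷ v)
∑-vecs n xs F = trans (∑-concatMap _ xs F) (∑-cong xs (λ x → ∑-map (x ∷_) (vecs n xs) F))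

length-∑ : (xs : List A) → length xs ≡ ∑[ _ ∈ xs ] 1
length-∑ xs = sym (trans (∑-const xs 1) (*-identityʳ _))

length-vecs : ∀ n (xs : List A) → length (vecs n xs) ≡ length xs ^ n
length-vecs zero xs = refl
length-vecs (suc n) xs = begin
  length (vecs (suc n) xs)               ≡⟨ length-∑ (vecs (suc n) xs) ⟩
  ∑[ _ ∈ vecs (suc n) xs ] 1             ≡⟨ ∑-vecs n xs _ ⟩
  ∑[ x ∈ xs ] ∑[ _ ∈ vecs n xs ] 1       ≡⟨ ∑-const xs _ ⟩
  length xs * ∑[ _ ∈ vecs n xs ] 1       ≡⟨ cong (length xs *_) (length-∑ (vecs n xs)) ⟨
  length xs * length (vecs n xs)         ≡⟨ cong (length xs *_) (length-vecs n xs) ⟩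
  length xs * length xs ^ n              ∎
  where open ≡-Reasoning

∈-vecs⁺ : ∀ {n} {xs : List A} (v : Vec A n) → (∀ i → lookupᵛ v i ∈ xs) → v ∈ vecs n xs
∈-vecs⁺ [] h = here refl
∈-vecs⁺ {xs = xs} (x ∷ v) h =
  ∈-concatMap⁺ _ (Any.map (λ { refl → ∈-map⁺ (x ∷_) (∈-vecs⁺ v (h ∘ suc)) }) (h zero))

∈-vecs⁻ : ∀ {n} {xs : List A} {v : Vec A n} → v ∈ vecs n xs → VAll.All (_∈ xs) v
∈-vecs⁻ {n = zero} {v = []} h = []
∈-vecs⁻ {n = suc n} {xs} h with find (∈-concatMap⁻ (λ x → map (x ∷_) (vecs n xs)) {xs = xs} h)
... | x , x∈ , v∈ with ∈-map⁻ (x ∷_) v∈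
...   | w , w∈ , refl = x∈ ∷ ∈-vecs⁻ w∈

-- Resampling one coordinate preserves the uniform distribution: every tuple arises from exactly
-- `length xs` pairs of a tuple and a new entry.
∑-vecs-update : ∀ {n} (b : Fin n) (xs : List A) (F : Vec A n → ℕ) →
  length xs * ∑ (vecs n xs) F ≡ ∑[ v ∈ vecs n xs ] ∑[ x ∈ xs ] F (v [ b ]≔ x)
∑-vecs-update {n = suc n} zero xs F = begin
  length xs * ∑ (vecs (suc n) xs) F                            ≡⟨ cong (length xs *_) (trans (∑-vecs n xs F) (∑-swap xs (vecs n xs) _)) ⟩
  length xs * ∑[ v ∈ vecs n xs ] ∑[ x ∈ xs ] F (x ∷ v)         ≡⟨ ∑-const xs _ ⟨
  ∑[ y ∈ xs ] ∑[ v ∈ vecs n xs ] ∑[ x ∈ xs ] F (x ∷ v)         ≡⟨ ∑-vecs n xs _ ⟨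
  ∑[ v ∈ vecs (suc n) xs ] ∑[ x ∈ xs ] F (v [ zero ]≔ x)       ∎
  where open ≡-Reasoning
∑-vecs-update {n = suc n} (suc b) xs F = begin
  length xs * ∑ (vecs (suc n) xs) F                            ≡⟨ cong (length xs *_) (∑-vecs n xs F) ⟩
  length xs * ∑[ x ∈ xs ] ∑[ v ∈ vecs n xs ] F (x ∷ v)         ≡⟨ ∑-*ˡ (length xs) xs _ ⟨
  ∑[ x ∈ xs ] (length xs * ∑[ v ∈ vecs n xs ] F (x ∷ v))       ≡⟨ ∑-cong xs (λ x → ∑-vecs-update b xs (F ∘ (x ∷_))) ⟩
  ∑[ x ∈ xs ] ∑[ v ∈ vecs n xs ] ∑[ y ∈ xs ] F (x ∷ (v [ b ]≔ y)) ≡⟨ ∑-vecs n xs _ ⟨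
  ∑[ v ∈ vecs (suc n) xs ] ∑[ x ∈ xs ] F (v [ suc b ]≔ x)      ∎
  where open ≡-Reasoning

∑-<-strict : (xs : List A) {f g : A → ℕ} → (∀ x → f x ≤ g x) → ∀ {y} → y ∈ xs → f y < g y → ∑ xs f < ∑ xs g
∑-<-strict (x ∷ xs) h (here refl) lt = +-mono-<-≤ lt (∑-mono xs (λ {x} _ → h x))
∑-<-strict (x ∷ xs) h (there y∈) lt = +-mono-≤-< (h x) (∑-<-strict xs h y∈ lt)

#-filter : {P Q : A → Set} (P? : Decidable P) (Q? : Decidable Q) (xs : List A) → # P? (filter Q? xs) ≤ # P? xs
#-filter P? Q? [] = z≤n
#-filter P? Q? (x ∷ xs) with Q? x
... | yes _ with P? x
...   | yes _ = s≤s (#-filter P? Q? xs)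
...   | no _ = #-filter P? Q? xs
#-filter P? Q? (x ∷ xs) | no _ with P? x
...   | yes _ = m≤n⇒m≤1+n (#-filter P? Q? xs)
...   | no _ = #-filter P? Q? xs

∑-∈ : (xs : List A) (f : A → ℕ) → ∀ {y} → y ∈ xs → f y ≤ ∑ xs f
∑-∈ (x ∷ xs) f (here refl) = m≤m+n _ _
∑-∈ (x ∷ xs) f (there y∈) = ≤-trans (∑-∈ xs f y∈) (m≤n+m _ _)

-- Conditioning on all coordinates except `b`: if the conditional probability is always at most 1/q,
-- so is the total one.
one-coordinate-bound : ∀ {n} {P : Vec A n → Set} (P? : Decidable P) (b : Fin n) (xs : List A) q →
  (∀ {v} → v ∈ vecs n xs → q * # (λ x → P? (v [ b ]≔ x)) xs ≤ length xs) → 0 < length xs →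
  q * # P? (vecs n xs) ≤ length (vecs n xs)
one-coordinate-bound {n = n} P? b xs q h 0<xs = *-cancelˡ-≤ (length xs) {{>-nonZero 0<xs}} (begin
  length xs * (q * # P? vs)                            ≡⟨ *-left-comm (length xs) q _ ⟩
  q * (length xs * # P? vs)                            ≡⟨ cong (λ z → q * (length xs * z)) (#-∑ P? vs) ⟩
  q * (length xs * ∑ vs (𝟙 ∘ P?))                      ≡⟨ cong (q *_) (∑-vecs-update b xs (𝟙 ∘ P?)) ⟩
  q * ∑[ v ∈ vs ] ∑[ x ∈ xs ] 𝟙 (P? (v [ b ]≔ x))      ≡⟨ ∑-*ˡ q vs _ ⟨
  ∑[ v ∈ vs ] (q * ∑[ x ∈ xs ] 𝟙 (P? (v [ b ]≔ x)))    ≡⟨ ∑-cong vs (λ v → cong (q *_) (#-∑ (λ x → P? (v [ b ]≔ x)) xs)) ⟨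
  ∑[ v ∈ vs ] (q * # (λ x → P? (v [ b ]≔ x)) xs)       ≤⟨ ∑-mono vs h ⟩
  ∑[ _ ∈ vs ] length xs                                ≡⟨ ∑-const vs _ ⟩
  length vs * length xs                                ≡⟨ *-comm (length vs) _ ⟩
  length xs * length vs                                ∎)
  where
  open ≤-Reasoning
  vs = vecs n xs

length-allFin : ∀ n → length (allFin n) ≡ n
length-allFin n = length-tabulate {n = n} _

VAll-lookup : ∀ {n} {P : A → Set} {v : Vec A n} → VAll.All P v → ∀ i → P (lookupᵛ v i)
VAll-lookup (p ∷ _) zero = p
VAll-lookup (_ ∷ ps) (suc i) = VAll-lookup ps i

-- Rainbow copies in locally sparse colourings

module _ {N : ℕ} (c : Fin N → Fin N → ℕ) where

  -- Only `b` has to differ from the other indices. Since `a`, `a'`, `b'` may coincide, this also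
  -- covers edges that meet and, with `a' = b' = a`, repeated vertices.
  Repeat : ∀ {n} → Vec (Fin n) 4 → Vec (Fin N) n → Set
  Repeat (a ∷ b ∷ a' ∷ b' ∷ []) v =
    (b ≢ a × b ≢ a' × b ≢ b') × c (lookupᵛ v a) (lookupᵛ v b) ≡ c (lookupᵛ v a') (lookupᵛ v b')

  Repeat? : ∀ {n} (e : Vec (Fin n) 4) (v : Vec (Fin N) n) → Dec (Repeat e v)
  Repeat? (a ∷ b ∷ a' ∷ b' ∷ []) v =
    (¬? (b Fin.≟ a) ×-dec ¬? (b Fin.≟ a') ×-dec ¬? (b Fin.≟ b')) ×-dec
    (c (lookupᵛ v a) (lookupᵛ v b) ≟ c (lookupᵛ v a') (lookupᵛ v b'))

  -- Fix every coordinate except b, the one that occurs only once among a, b, a', b'.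
  tuple-without-repeats : ∀ n (L : List (Fin N)) q →
    (∀ {v} κ → v ∈ L → q * # (λ x → c v x ≟ κ) L ≤ length L) → n ^ 4 < q → 0 < length L →
    ∃ λ (φ : Fin n → Fin N) → ∀ a b a' b' → b ≢ a → b ≢ a' → b ≢ b' → c (φ a) (φ b) ≢ c (φ a') (φ b')
  tuple-without-repeats n L q sparse n⁴<q 0<L
    with union-bound Repeat? (vecs n L) (vecs 4 (allFin n)) q (λ {e} _ → bound e)
           (subst (_< q) (sym (trans (length-vecs 4 (allFin n)) (cong (_^ 4) (length-allFin n)))) n⁴<q)
           (subst (0 <_) (sym (length-vecs n L)) (m^n>0 (length L) {{>-nonZero 0<L}} n))
    where
    bound : ∀ e → q * # (Repeat? e) (vecs n L) ≤ length (vecs n L)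
    bound e@(a ∷ b ∷ a' ∷ b' ∷ []) = one-coordinate-bound (Repeat? e) b L q
      (λ {v} v∈ → ≤-trans
        (*-monoʳ-≤ q (#-mono (λ x → Repeat? e (v [ b ]≔ x)) (λ x → c (lookupᵛ v a) x ≟ c (lookupᵛ v a') (lookupᵛ v b')) L
          (λ {x} _ → λ { ((b≢a , b≢a' , b≢b') , eq) →
            trans (sym (cong₂ c (lookup∘update′ (b≢a ∘ sym) v x) (lookup∘update b v x)))
            (trans eq (cong₂ c (lookup∘update′ (b≢a' ∘ sym) v x) (lookup∘update′ (b≢b' ∘ sym) v x))) })))
        (sparse (c (lookupᵛ v a') (lookupᵛ v b')) (VAll-lookup (∈-vecs⁻ v∈) a)))
      0<L
  ... | v , _ , good = lookupᵛ v , λ a b a' b' b≢a b≢a' b≢b' eq →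
    good (∈-vecs⁺ (a ∷ b ∷ a' ∷ b' ∷ []) (λ _ → ∈-allFin _)) ((b≢a , b≢a' , b≢b') , eq)

  -- Of two distinct edges, the first has an endpoint outside the second. Symmetry of `c` lets this
  -- endpoint play the part of `b` in `tuple-without-repeats`.
  rainbow-copy : (∀ i j → c i j ≡ c j i) → ∀ {n} (H : Graph n) (L : List (Fin N)) q →
    (∀ {v} κ → v ∈ L → q * # (λ x → c v x ≟ κ) L ≤ length L) → n ^ 4 < q → 0 < length L →
    ∃ λ (φ : Fin n → Fin N) → Injective _≡_ _≡_ φ × Rainbow H c φ
  rainbow-copy c-sym {n} H L q sparse n⁴<q 0<L with tuple-without-repeats n L q sparse n⁴<q 0<L
  ... | φ , good = φ , inj , rainbow
    where
    inj : Injective _≡_ _≡_ φ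
    inj {a} {b} eq with b Fin.≟ a
    ... | yes p = sym p
    ... | no b≢a = ⊥-elim (good a b a a b≢a b≢a b≢a (cong (c (φ a)) (sym eq)))
    edge-≢ : ∀ {u v} → Edge H u v → u ≢ v
    edge-≢ {u} e refl with trans (sym e) (irrefl H u)
    ... | ()
    rainbow : Rainbow H c φ
    rainbow u v u' v' e e' eq with v Fin.≟ u' | v Fin.≟ v'
    ... | no v≢u' | no v≢v' = ⊥-elim (good u v u' v' (edge-≢ e ∘ sym) v≢u' v≢v' eq)
    ... | yes refl | yes refl = ⊥-elim (edge-≢ e' refl)
    ... | no _ | yes refl with u Fin.≟ u'
    ...   | yes refl = inj₁ (refl , refl)
    ...   | no u≢u' = ⊥-elim (good v u u' v (edge-≢ e) u≢u' (edge-≢ e) (trans (c-sym _ _) eq))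
    rainbow u v u' v' e e' eq | yes refl | no _ with u Fin.≟ v'
    ...   | yes refl = inj₂ (refl , refl)
    ...   | no u≢v' = ⊥-elim (good v u v v' (edge-≢ e) (edge-≢ e) u≢v' (trans (c-sym _ _) eq))

#-vecs-All : ∀ t {P : A → Set} (P? : Decidable P) (xs : List A) → # (VAll.all? P?) (vecs t xs) ≡ # P? xs ^ t
#-vecs-All zero P? xs = refl
#-vecs-All (suc t) P? xs = begin
  # (VAll.all? P?) (vecs (suc t) xs)                               ≡⟨ #-∑ (VAll.all? P?) (vecs (suc t) xs) ⟩
  ∑[ v ∈ vecs (suc t) xs ] 𝟙 (VAll.all? P? v)                      ≡⟨ ∑-vecs t xs _ ⟩
  ∑[ x ∈ xs ] ∑[ v ∈ vecs t xs ] 𝟙 (VAll.all? P? (x ∷ v))          ≡⟨ ∑-cong xs (λ x → ∑-cong (vecs t xs) (λ v → split x v)) ⟩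
  ∑[ x ∈ xs ] ∑[ v ∈ vecs t xs ] (𝟙 (VAll.all? P? v) * 𝟙 (P? x))   ≡⟨ ∑-cong xs (λ x → inner x) ⟩
  ∑[ x ∈ xs ] (# P? xs ^ t * 𝟙 (P? x))                             ≡⟨ ∑-*ˡ (# P? xs ^ t) xs _ ⟩
  # P? xs ^ t * ∑[ x ∈ xs ] 𝟙 (P? x)                               ≡⟨ cong (# P? xs ^ t *_) (#-∑ P? xs) ⟨
  # P? xs ^ t * # P? xs                                            ≡⟨ *-comm (# P? xs ^ t) _ ⟩
  # P? xs * # P? xs ^ t                                            ∎
  where
  open ≡-Reasoning
  -- Independence: the indicator of a tuple factors over its coordinates.
  split : ∀ x v → 𝟙 (VAll.all? P? (x ∷ v)) ≡ 𝟙 (VAll.all? P? v) * 𝟙 (P? x)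
  split x v with P? x | VAll.all? P? v
  ... | yes _ | yes _ = refl
  ... | yes _ | no _ = refl
  ... | no _ | yes _ = refl
  ... | no _ | no _ = refl
  inner : ∀ x → ∑[ v ∈ vecs t xs ] (𝟙 (VAll.all? P? v) * 𝟙 (P? x)) ≡ # P? xs ^ t * 𝟙 (P? x)
  inner x = begin
    ∑[ v ∈ vecs t xs ] (𝟙 (VAll.all? P? v) * 𝟙 (P? x))  ≡⟨ ∑-cong (vecs t xs) (λ v → *-comm (𝟙 (VAll.all? P? v)) _) ⟩
    ∑[ v ∈ vecs t xs ] (𝟙 (P? x) * 𝟙 (VAll.all? P? v))  ≡⟨ ∑-*ˡ (𝟙 (P? x)) (vecs t xs) _ ⟩
    𝟙 (P? x) * ∑[ v ∈ vecs t xs ] 𝟙 (VAll.all? P? v)    ≡⟨ cong (𝟙 (P? x) *_) (#-∑ (VAll.all? P?) (vecs t xs)) ⟨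
    𝟙 (P? x) * # (VAll.all? P?) (vecs t xs)             ≡⟨ cong (𝟙 (P? x) *_) (#-vecs-All t P? xs) ⟩
    𝟙 (P? x) * # P? xs ^ t                              ≡⟨ *-comm (𝟙 (P? x)) _ ⟩
    # P? xs ^ t * 𝟙 (P? x)                              ∎

-- Dependent random choice

*-^-distrib : ∀ a b n → (a * b) ^ n ≡ a ^ n * b ^ n
*-^-distrib a b zero = refl
*-^-distrib a b (suc n) = trans (cong (a * b *_) (*-^-distrib a b n)) ([m*n]*[o*p]≡[m*o]*[n*p] a b (a ^ n) (b ^ n))

module _ {R : A → B → Set} (R? : ∀ a b → Dec (R a b)) where

  joint? : (Q : List A) → Decidable (λ x → All (λ v → R v x) Q)
  joint? Q x = All.all? (λ v → R? v x) Q

  private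
    jointV? : ∀ {d} (Q : Vec A d) → Decidable (λ x → VAll.All (λ v → R v x) Q)
    jointV? Q x = VAll.all? (λ v → R? v x) Q

    transpose : ∀ {t} {Q : List A} (T : Vec B t) → All (λ v → VAll.All (R v) T) Q →
      VAll.All (λ x → VAll.All (λ v → R v x) (fromList Q)) T
    transpose [] h = []
    transpose (x ∷ T) h = VAll.fromList⁺ (All.map VAll.head h) ∷ transpose T (All.map VAll.tail h)

    VAll-∈ : ∀ {n} {xs : List A} (v : Vec A n) → VAll.All (_∈ xs) v → v ∈ vecs n xs
    VAll-∈ v h = ∈-vecs⁺ v (VAll-lookup h)

  -- The set A consists of the common in-neighbours of t = d + 2 random elements of S;
  -- a d-tuple with at most h common out-neighbours survives with probability at most (h/|S|)^t.
  dependent-random-choice : ∀ (P : List A) (S : List B) d h q m →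
    (∀ {v} → v ∈ P → length S ≤ q * # (R? v) S) → length P ≤ length S → h ≤ q →
    q ^ (2 + d) * suc m < length P →
    ∃ λ A' → A' ⊆ P × (Unique P → Unique A') × m < length A' ×
      (∀ Q → length Q ≡ d → Q ⊆ A' → h < # (joint? Q) S)
  dependent-random-choice P S d h q m dense P≤S h≤q large = result
    where
    open ≤-Reasoning
    t = 2 + d
    p = length P
    s = length S
    Ts = vecs t S
    bad : List (Vec A d)
    bad = filter (λ Q → # (jointV? Q) S ≤? h) (vecs d P)
    in? : (T : Vec B t) → Decidable (λ v → VAll.All (R v) T)
    in? T v = VAll.all? (R? v) T
    survivors : Vec B t → ℕ
    survivors T = ∑[ Q ∈ bad ] 𝟙 (VAll.all? (jointV? Q) T)

    ∑-survivors : ∑ Ts survivors ≤ p ^ d * h ^ t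
    ∑-survivors = begin
      ∑ Ts survivors                                             ≡⟨ ∑-swap Ts bad _ ⟩
      ∑[ Q ∈ bad ] ∑[ T ∈ Ts ] 𝟙 (VAll.all? (jointV? Q) T)       ≡⟨ ∑-cong bad (λ Q → trans (sym (#-∑ (VAll.all? (jointV? Q)) Ts)) (#-vecs-All t (jointV? Q) S)) ⟩
      ∑[ Q ∈ bad ] (# (jointV? Q) S ^ t)                           ≤⟨ ∑-mono bad (λ Q∈ → ^-monoˡ-≤ t (proj₂ (∈-filter⁻ (λ Q → # (jointV? Q) S ≤? h) {xs = vecs d P} Q∈))) ⟩
      ∑[ _ ∈ bad ] (h ^ t)                                         ≡⟨ ∑-const bad _ ⟩
      length bad * h ^ t                                         ≤⟨ *-monoˡ-≤ (h ^ t) (≤-trans (length-filter _ (vecs d P)) (≤-reflexive (length-vecs d P))) ⟩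
      p ^ d * h ^ t                                              ∎

    0<p : 0 < p
    0<p = ≤-<-trans z≤n large

    0<s : 0 < s
    0<s = ≤-trans 0<p P≤S

    -- This explains the exponent `t = 2 + d`: the `p ^ d` tuples and the weight `p` below use up
    -- `1 + d` factors `s`, and `h ^ t` costs one more.
    hᵗ≤s : h ^ t ≤ s
    hᵗ≤s = begin
      h ^ t          ≤⟨ ^-monoˡ-≤ t h≤q ⟩
      q ^ t          ≤⟨ m≤m*n (q ^ t) (suc m) ⟩
      q ^ t * suc m  ≤⟨ <⇒≤ large ⟩
      p              ≤⟨ P≤S ⟩
      s              ∎

    upper : ∑[ T ∈ Ts ] (m + p * survivors T) ≤ suc m * s ^ t
    upper = begin
      ∑[ T ∈ Ts ] (m + p * survivors T)             ≡⟨ ∑-+ Ts (λ _ → m) _ ⟩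
      ∑[ T ∈ Ts ] m + ∑[ T ∈ Ts ] (p * survivors T) ≡⟨ cong₂ _+_ (trans (∑-const Ts m) (trans (cong (_* m) (length-vecs t S)) (*-comm (s ^ t) m))) (∑-*ˡ p Ts survivors) ⟩
      m * s ^ t + p * ∑ Ts survivors                ≤⟨ +-monoʳ-≤ (m * s ^ t) (*-monoʳ-≤ p ∑-survivors) ⟩
      m * s ^ t + p * (p ^ d * h ^ t)               ≡⟨ cong (m * s ^ t +_) (*-assoc p (p ^ d) (h ^ t)) ⟨
      m * s ^ t + p ^ (1 + d) * h ^ t               ≤⟨ +-monoʳ-≤ (m * s ^ t) (*-mono-≤ (^-monoˡ-≤ (1 + d) P≤S) hᵗ≤s) ⟩
      m * s ^ t + s ^ (1 + d) * s                   ≡⟨ cong (m * s ^ t +_) (*-comm (s ^ (1 + d)) s) ⟩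
      m * s ^ t + s ^ t                             ≡⟨ +-comm (m * s ^ t) (s ^ t) ⟩
      suc m * s ^ t                                 ∎

    lower : p * s ^ t ≤ q ^ t * ∑[ T ∈ Ts ] # (in? T) P
    lower = begin
      p * s ^ t                                       ≡⟨ ∑-const P (s ^ t) ⟨
      ∑[ _ ∈ P ] (s ^ t)                                ≤⟨ ∑-mono P (λ v∈ → ^-monoˡ-≤ t (dense v∈)) ⟩
      ∑[ v ∈ P ] ((q * # (R? v) S) ^ t)                 ≡⟨ ∑-cong P (λ v → *-^-distrib q (# (R? v) S) t) ⟩
      ∑[ v ∈ P ] (q ^ t * # (R? v) S ^ t)             ≡⟨ ∑-*ˡ (q ^ t) P _ ⟩
      q ^ t * ∑[ v ∈ P ] (# (R? v) S ^ t)               ≡⟨ cong (q ^ t *_) (∑-cong P (λ v → trans (sym (#-vecs-All t (R? v) S)) (#-∑ (VAll.all? (R? v)) Ts))) ⟩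
      q ^ t * ∑[ v ∈ P ] ∑[ T ∈ Ts ] 𝟙 (in? T v)      ≡⟨ cong (q ^ t *_) (∑-swap P Ts _) ⟩
      q ^ t * ∑[ T ∈ Ts ] ∑[ v ∈ P ] 𝟙 (in? T v)      ≡⟨ cong (q ^ t *_) (∑-cong Ts (λ T → #-∑ (in? T) P)) ⟨
      q ^ t * ∑[ T ∈ Ts ] # (in? T) P                 ∎

    -- The weight `p` makes one inequality serve twice. For a good `T`, more than `m` elements are
    -- chosen; and as at most `p` can be chosen, no bad tuple survives.
    average : ∑[ T ∈ Ts ] (m + p * survivors T) < ∑[ T ∈ Ts ] # (in? T) P
    average = *-cancelˡ-< (q ^ t) _ _ (begin-strict
      q ^ t * ∑[ T ∈ Ts ] (m + p * survivors T)  ≤⟨ *-monoʳ-≤ (q ^ t) upper ⟩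
      q ^ t * (suc m * s ^ t)                    ≡⟨ *-assoc (q ^ t) (suc m) (s ^ t) ⟨
      q ^ t * suc m * s ^ t                      <⟨ *-monoˡ-< (s ^ t) {{>-nonZero (m^n>0 s {{>-nonZero 0<s}} t)}} large ⟩
      p * s ^ t                                  ≤⟨ lower ⟩
      q ^ t * ∑[ T ∈ Ts ] # (in? T) P            ∎)

    result : ∃ λ A' → A' ⊆ P × (Unique P → Unique A') × m < length A' ×
      (∀ Q → length Q ≡ d → Q ⊆ A' → h < # (joint? Q) S)
    result with ∑-<-∃ Ts _ _ average
    ... | T , _ , lt = filter (in? T) P , (λ v∈ → proj₁ (∈-filter⁻ (in? T) {xs = P} v∈)) , filter⁺ (in? T) ,
                       ≤-<-trans (m≤m+n m _) lt , rich
      where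
      survivors≤0 : survivors T < 1
      survivors≤0 = *-cancelˡ-< p _ _ (begin-strict
        p * survivors T     ≤⟨ m≤n+m _ m ⟩
        m + p * survivors T <⟨ lt ⟩
        # (in? T) P         ≤⟨ length-filter (in? T) P ⟩
        p                   ≡⟨ *-identityʳ p ⟨
        p * 1               ∎)
      dead : ∀ (Qs : List (Vec A d)) {Q} → Q ∈ Qs → VAll.All (λ x → VAll.All (λ v → R v x) Q) T →
        1 ≤ ∑[ Q ∈ Qs ] 𝟙 (VAll.all? (jointV? Q) T)
      dead (Q ∷ Qs) (here refl) h = ≤-trans (≤-reflexive (sym (𝟙-yes (VAll.all? (jointV? Q) T) h))) (m≤m+n _ _)
      dead (Q ∷ Qs) (there Q∈) h = ≤-trans (dead Qs Q∈ h) (m≤n+m _ _)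
      -- A tuple of chosen elements with few joint neighbours would be bad and, once the two
      -- quantifiers are exchanged by `transpose`, would survive `T`.
      rich : ∀ Q → length Q ≡ d → Q ⊆ filter (in? T) P → h < # (joint? Q) S
      rich Q refl Q⊆ = ≰⇒> λ few → <⇒≱ survivors≤0 (dead bad
        (∈-filter⁺ (λ (Q : Vec A d) → # (jointV? Q) S ≤? h)
          (VAll-∈ (fromList Q) (VAll.fromList⁺ (All.tabulate (λ v∈ → proj₁ (∈-filter⁻ (in? T) {xs = P} (Q⊆ v∈))))))
          (≤-trans (#-mono (jointV? (fromList Q)) (joint? Q) S (λ _ → VAll.fromList⁻)) few))
        (transpose T (All.tabulate (λ v∈ → proj₂ (∈-filter⁻ (in? T) {xs = P} (Q⊆ v∈))))))

-- Greedy choice of distinct representatives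

module _ (_≟A_ : DecidableEquality A) where

  #-≡-Unique : (y : A) {C : List A} → Unique C → # (y ≟A_) C ≤ 1
  #-≡-Unique y {[]} [] = z≤n
  #-≡-Unique y {x ∷ C} (x∉ ∷ u) with y ≟A x
  ... | no _ = #-≡-Unique y u
  ... | yes refl = s≤s (≤-reflexive (none x∉))
    where
    none : ∀ {C} → All (y ≢_) C → # (y ≟A_) C ≡ 0
    none [] = refl
    none {z ∷ C} (y≢z ∷ h) with y ≟A z
    ... | yes eq = ⊥-elim (y≢z eq)
    ... | no _ = none h

  fresh : (C F : List A) → Unique C → length F < length C → ∃ λ x → x ∈ C × x ∉ F
  fresh (x ∷ C) [] u lt = x , here refl , λ ()
  fresh C (y ∷ F) u lt
    with fresh (filter (¬? ∘ (y ≟A_)) C) F (filter⁺ _ u) (+-cancelˡ-< 1 _ _ (begin-strict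
      1 + length F                                 <⟨ lt ⟩
      length C                                     ≡⟨ #-complement (y ≟A_) C ⟨
      # (y ≟A_) C + # (¬? ∘ (y ≟A_)) C             ≤⟨ +-monoˡ-≤ _ (#-≡-Unique y u) ⟩
      1 + # (¬? ∘ (y ≟A_)) C                       ∎))
    where open ≤-Reasoning
  ... | x , x∈ , x∉ with ∈-filter⁻ (¬? ∘ (y ≟A_)) {xs = C} x∈
  ...   | x∈C , y≢x = x , x∈C , λ { (here refl) → y≢x refl ; (there x∈F) → x∉ x∈F }

  -- Greedy choice. Each chosen element joins the forbidden list `F`, so `length F` plus the number
  -- of choices still to be made stays constant.
  distinct-representatives : ∀ m (C : Fin m → List A) (F : List A) → (∀ i → Unique (C i)) →
    (∀ i → length F + m ≤ length (C i)) →
    ∃ λ (ψ : Fin m → A) → Injective _≡_ _≡_ ψ × (∀ i → ψ i ∈ C i) × (∀ i → ψ i ∉ F)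
  distinct-representatives zero C F u h = (λ ()) , (λ { {()} }) , (λ ()) , (λ ())
  distinct-representatives (suc m) C F u h
    with fresh (C zero) F (u zero) (≤-trans (≤-reflexive (sym (+-comm (length F) 1))) (≤-trans (+-monoʳ-≤ (length F) (s≤s z≤n)) (h zero)))
  ... | x , x∈ , x∉ with distinct-representatives m (C ∘ suc) (x ∷ F) (u ∘ suc) (λ i → ≤-trans (≤-reflexive (sym (+-suc (length F) m))) (h (suc i)))
  ...   | ψ , inj , ψ∈ , ψ∉ = ψ' , inj' , (λ { zero → x∈ ; (suc i) → ψ∈ i }) , (λ { zero → x∉ ; (suc i) → ψ∉ i ∘ there })
    where
    ψ' : Fin (suc m) → A
    ψ' zero = x
    ψ' (suc i) = ψ i
    inj' : Injective _≡_ _≡_ ψ'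
    inj' {zero} {zero} eq = refl
    inj' {zero} {suc j} eq = ⊥-elim (ψ∉ j (here (sym eq)))
    inj' {suc i} {zero} eq = ⊥-elim (ψ∉ i (here eq))
    inj' {suc i} {suc j} eq = cong suc (inj eq)

-- Embedding

-- Turns distinct priorities into an ordering of the kind that `Lexicographic` asks for. The
-- position of `u` is the number of vertices of smaller priority, which is below `n` because `u` is
-- not among them.
rank : ∀ {n} (g : Fin n → ℕ) → Injective _≡_ _≡_ g →
  ∃ λ (pos : Fin n → Fin n) → Injective _≡_ _≡_ pos × (∀ u w → toℕ (pos u) < toℕ (pos w) → g u < g w)
rank {n} g g-inj = pos , inj , λ u w lt → ≰⇒> λ gw≤gu → <⇒≱ lt (mono w u gw≤gu)
  where
  open ≤-Reasoning
  below? : ∀ u → Decidable (λ w → g w < g u)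
  below? u w = g w <? g u
  r : Fin n → ℕ
  r u = # (below? u) (allFin n)
  r<n : ∀ u → r u < n
  r<n u = <-≤-trans (filter-notAll (below? u) (allFin n) (lose (∈-allFin u) (n≮n (g u)))) (≤-reflexive (length-allFin n))
  pos : Fin n → Fin n
  pos u = fromℕ< (r<n u)
  r-strict : ∀ u w → g u < g w → r u < r w
  r-strict u w lt = begin-strict
    r u                                                            ≡⟨ #-∑ (below? u) (allFin n) ⟩
    ∑[ x ∈ allFin n ] 𝟙 (below? u x)                               <⟨ ∑-<-strict (allFin n) (λ x → 𝟙-mono (below? u x) (below? w x) (λ p → <-trans p lt)) (∈-allFin u)
                                                                       (≤-reflexive (trans (cong suc (𝟙-no (below? u u) (n≮n (g u)))) (sym (𝟙-yes (below? w u) lt)))) ⟩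
    ∑[ x ∈ allFin n ] 𝟙 (below? w x)                               ≡⟨ #-∑ (below? w) (allFin n) ⟨
    r w                                                            ∎
  inj : Injective _≡_ _≡_ pos
  inj {u} {w} eq with ℕ.<-cmp (g u) (g w)
  ... | tri< lt _ _ = ⊥-elim (<⇒≢ (r-strict u w lt) (Fin.fromℕ<-injective _ _ (r<n u) (r<n w) eq))
  ... | tri≈ _ e _ = g-inj e
  ... | tri> _ _ gt = ⊥-elim (<⇒≢ (r-strict w u gt) (Fin.fromℕ<-injective _ _ (r<n w) (r<n u) (sym eq)))
  mono : ∀ u w → g u ≤ g w → toℕ (pos u) ≤ toℕ (pos w)
  mono u w le = subst₂ _≤_ (sym (Fin.toℕ-fromℕ< (r<n u))) (sym (Fin.toℕ-fromℕ< (r<n w)))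
    (#-mono (below? u) (below? w) (allFin n) (λ _ p → <-≤-trans p le))

-- If no fibre of `κ` has `n` elements, deleting the fibre of the first element costs fewer than `n`
-- elements and leaves only other values; `m` rounds give `m` distinct values.
constant-or-injective : ∀ n m → 0 < n → (κ : A → ℕ) (xs : List A) → m * n ≤ length xs →
  (∃ λ x → n ≤ # (λ y → κ y ≟ κ x) xs) ⊎
  (∃ λ (ψ : Fin m → A) → Injective _≡_ _≡_ (κ ∘ ψ) × (∀ i → ψ i ∈ xs))
constant-or-injective n zero 0<n κ xs h = inj₂ ((λ ()) , (λ { {()} }) , λ ())
constant-or-injective n (suc m) 0<n κ [] h = ⊥-elim (<⇒≱ 0<n (m+n≤o⇒m≤o n h))
constant-or-injective n (suc m) 0<n κ (x ∷ xs) h with n ≤? # (λ y → κ y ≟ κ x) (x ∷ xs)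
... | yes p = inj₁ (x , p)
... | no ¬p with constant-or-injective n m 0<n κ (filter (λ y → ¬? (κ y ≟ κ x)) (x ∷ xs)) rest
  where
  open ≤-Reasoning
  rest : m * n ≤ # (λ y → ¬? (κ y ≟ κ x)) (x ∷ xs)
  rest = +-cancelˡ-≤ n _ _ (begin
    n + m * n                                                                   ≤⟨ h ⟩
    length (x ∷ xs)                                                             ≡⟨ #-complement (λ y → κ y ≟ κ x) (x ∷ xs) ⟨
    # (λ y → κ y ≟ κ x) (x ∷ xs) + # (λ y → ¬? (κ y ≟ κ x)) (x ∷ xs)            ≤⟨ +-monoˡ-≤ _ (≰⇒≥ ¬p) ⟩
    n + # (λ y → ¬? (κ y ≟ κ x)) (x ∷ xs)                                       ∎)
...   | inj₁ (y , p) = inj₁ (y , ≤-trans p (#-filter (λ z → κ z ≟ κ y) (λ y → ¬? (κ y ≟ κ x)) (x ∷ xs)))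
...   | inj₂ (ψ , inj , ψ∈) = inj₂ (ψ' , inj' , λ { zero → here refl ; (suc i) → proj₁ (ψ∈' i) })
  where
  ψ∈' : ∀ i → ψ i ∈ x ∷ xs × κ (ψ i) ≢ κ x
  ψ∈' i = ∈-filter⁻ (λ y → ¬? (κ y ≟ κ x)) {xs = x ∷ xs} (ψ∈ i)
  ψ' : Fin (suc m) → _
  ψ' zero = x
  ψ' (suc i) = ψ i
  inj' : Injective _≡_ _≡_ (κ ∘ ψ')
  inj' {zero} {zero} eq = refl
  inj' {zero} {suc j} eq = ⊥-elim (proj₂ (ψ∈' j) (sym eq))
  inj' {suc i} {zero} eq = ⊥-elim (proj₂ (ψ∈' i) eq)
  inj' {suc i} {suc j} eq = cong suc (inj eq)

neighbours : ∀ {n} → Graph n → Fin n → List (Fin n)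
neighbours {n} H u = filter (λ w → adj H u w Bool.≟ true) (allFin n)

length-neighbours : ∀ {n} (H : Graph n) u → length (neighbours H u) ≡ degree H u
length-neighbours {n} H u = trans (#-∑ (λ w → adj H u w Bool.≟ true) (allFin n)) (∑-cong (allFin n) (λ w → indicator (adj H u w)))
  where
  indicator : ∀ b → 𝟙 (b Bool.≟ true) ≡ (if b then 1 else 0)
  indicator true = refl
  indicator false = refl

module _ {N n d : ℕ} (H : Graph n) (regular : Regular H d) where

  private
    V = Fin N

  -- The length `d` is the size of a neighbourhood in `H`. The threshold `n + n` leaves room for `n`
  -- new vertices that avoid `n` images already in use.
  Rich : {R : V → V → Set} → (∀ v w → Dec (R v w)) → List V → List V → Set
  Rich R? S' S = ∀ Q → length Q ≡ d → Q ⊆ S' → n + n < # (joint? R? Q) S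

  -- Every vertex gets a representative among the joint neighbours of the images of its `d`
  -- neighbours, distinct from all old images; only the vertices in `In` move there. The relation
  -- ties the new place of `u` to the old places of its neighbours, which do not change when `In` is
  -- independent.
  re-embed : ∀ {R : V → V → Set} (R? : ∀ v w → Dec (R v w)) {S' S} → Rich R? S' S → Unique S →
    (φ : Fin n → V) → Injective _≡_ _≡_ φ → (∀ u → φ u ∈ S') → {In : Fin n → Set} (In? : Decidable In) →
    ∃ λ (φ' : Fin n → V) → Injective _≡_ _≡_ φ' × (∀ u → ¬ In u → φ' u ≡ φ u) ×
      (∀ u → In u → φ' u ∈ S × (∀ w → Edge H u w → R (φ w) (φ' u)))
  re-embed {R} R? {S'} {S} rich uniq φ φ-inj φ∈ {In} In? = result
    where
    F = map φ (allFin n)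
    Q : Fin n → List V
    Q u = map φ (neighbours H u)
    Q⊆ : ∀ u → Q u ⊆ S'
    Q⊆ u v∈ with ∈-map⁻ φ v∈
    ... | w , _ , refl = φ∈ w
    C : Fin n → List V
    C u = filter (joint? R? (Q u)) S
    large : ∀ u → length F + n ≤ length (C u)
    large u = ≤-trans (≤-reflexive (cong (_+ n) (trans (length-map φ (allFin n)) (length-allFin n))))
      (<⇒≤ (rich (Q u) (trans (length-map φ (neighbours H u)) (trans (length-neighbours H u) (regular u))) (Q⊆ u)))
    φ-∈F : ∀ u → φ u ∈ F
    φ-∈F u = ∈-map⁺ φ (∈-allFin u)
    result : ∃ λ (φ' : Fin n → V) → Injective _≡_ _≡_ φ' × (∀ u → ¬ In u → φ' u ≡ φ u) ×
      (∀ u → In u → φ' u ∈ S × (∀ w → Edge H u w → R (φ w) (φ' u)))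
    result with distinct-representatives Fin._≟_ n C F (λ u → filter⁺ (joint? R? (Q u)) uniq) large
    ... | ψ , ψ-inj , ψ∈ , ψ∉ = φ' , inj , stay , move
      where
      φ' : Fin n → V
      φ' u with In? u
      ... | yes _ = ψ u
      ... | no _ = φ u
      inj : Injective _≡_ _≡_ φ'
      inj {u} {w} eq with In? u | In? w
      ... | yes _ | yes _ = ψ-inj eq
      ... | yes _ | no _ = ⊥-elim (ψ∉ u (subst (_∈ F) (sym eq) (φ-∈F w)))
      ... | no _ | yes _ = ⊥-elim (ψ∉ w (subst (_∈ F) eq (φ-∈F u)))
      ... | no _ | no _ = φ-inj eq
      stay : ∀ u → ¬ In u → φ' u ≡ φ u
      stay u ¬in with In? u
      ... | yes i = ⊥-elim (¬in i)
      ... | no _ = refl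
      chosen : ∀ u → ψ u ∈ S × (∀ w → Edge H u w → R (φ w) (ψ u))
      chosen u with ∈-filter⁻ (joint? R? (Q u)) {xs = S} (ψ∈ u)
      ... | ψ∈S , joint = ψ∈S , λ w e →
        All.lookup joint (∈-map⁺ φ (∈-filter⁺ (λ w → adj H u w Bool.≟ true) (∈-allFin w) e))
      move : ∀ u → In u → φ' u ∈ S × (∀ w → Edge H u w → R (φ w) (φ' u))
      move u i with In? u
      ... | no ¬i = ⊥-elim (¬i i)
      ... | yes _ = chosen u

AllPairs-lookup : {A : Set} {R : A → A → Set} {xs : List A} → AllPairs R xs →
  ∀ i j → toℕ i < toℕ j → R (lookup xs i) (lookup xs j)
AllPairs-lookup {xs = x ∷ xs} (h ∷ _) zero (suc j) lt = All.lookup h (∈-lookup {xs = xs} j)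
AllPairs-lookup {xs = x ∷ xs} (_ ∷ ap) (suc i) (suc j) (s≤s lt) = AllPairs-lookup ap i j lt

-- Upper bounds: towers, popular vertices and favourite colours

module Upper {N n d : ℕ} (H : Graph n) (regular : Regular H d)
  (c : Fin N → Fin N → ℕ) (c-sym : ∀ i j → c i j ≡ c j i) where

  V : Set
  V = Fin N

  Copy : (Fin n → V) → Set
  Copy φ = Injective _≡_ _≡_ φ × Canonical H c φ

  colour? : ∀ κ v w → Dec (c v w ≡ κ)
  colour? κ v w = c v w ≟ κ

  -- The list in the index is the innermost set of a descending chain. Any `d` vertices of it have
  -- many common neighbours in colour `κ` inside the next larger set.
  data Tower (κ : ℕ) : ℕ → List V → Set where
    base : ∀ {S} → Unique S → Tower κ 0 S
    step : ∀ {j S S'} → Tower κ j S → Unique S' → S' ⊆ S → Rich H regular (colour? κ) S' S → Tower κ (suc j) S'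

  Tower-⊆ : ∀ {κ j S S'} → Unique S' → S' ⊆ S → Tower κ j S → Tower κ j S'
  Tower-⊆ uniq ⊆ (base _) = base uniq
  Tower-⊆ uniq ⊆ (step T _ ⊆' rich) = step T uniq (⊆' ∘ ⊆) (λ Q len Q⊆ → rich Q len (⊆ ∘ Q⊆))

  Tower-Unique : ∀ {κ j S} → Tower κ j S → Unique S
  Tower-Unique (base u) = u
  Tower-Unique (step _ u _ _) = u

  module _ {κ : ℕ} (f : Fin n → ℕ) (proper : ∀ u w → Edge H u w → f u ≢ f w) where

    -- Class `i` moves at once, being independent, from the innermost set into the next larger one,
    -- to common neighbours in colour `κ` of the images of its neighbours. This colours its edges to
    -- the earlier classes correctly. The whole copy now lies in the larger set, where class `i + 1`
    -- is treated in the same way.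
    climb : ∀ {j S} i → Tower κ j S → (φ : Fin n → V) → Injective _≡_ _≡_ φ → (∀ u → φ u ∈ S) →
      (∀ u w → Edge H u w → f u < i → f w < i → c (φ u) (φ w) ≡ κ) →
      ∃ λ (φ' : Fin n → V) → Injective _≡_ _≡_ φ' ×
        (∀ u w → Edge H u w → f u < i + j → f w < i + j → c (φ' u) (φ' w) ≡ κ)
    climb i (base _) φ inj φ∈ mono = φ , inj , λ u w e p q →
      mono u w e (subst (f u <_) (+-identityʳ i) p) (subst (f w <_) (+-identityʳ i) q)
    climb {suc j} i (step {S = S} T _ S'⊆S rich) φ inj φ∈ mono
      with re-embed H regular (colour? κ) rich (Tower-Unique T) φ inj φ∈ (λ u → f u ≟ i)
    ... | φ' , inj' , stay , move with climb (suc i) T φ' inj' φ'∈ mono'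
      where
      φ'∈ : ∀ u → φ' u ∈ S
      φ'∈ u with f u ≟ i
      ... | yes p = proj₁ (move u p)
      ... | no p = subst (_∈ S) (sym (stay u p)) (S'⊆S (φ∈ u))
      mono' : ∀ u w → Edge H u w → f u < suc i → f w < suc i → c (φ' u) (φ' w) ≡ κ
      mono' u w e fu fw with f u ≟ i | f w ≟ i
      ... | yes p | yes q = ⊥-elim (proper u w e (trans p (sym q)))
      ... | yes p | no q = trans (c-sym _ _) (trans (cong (λ z → c z (φ' u)) (stay w q)) (proj₂ (move u p) w e))
      ... | no p | yes q = trans (cong (λ z → c z (φ' w)) (stay u p)) (proj₂ (move w q) u (trans (adj-sym H w u) e))
      ... | no p | no q = trans (cong₂ c (stay u p) (stay w q)) (mono u w e (≤∧≢⇒< (≤-pred fu) p) (≤∧≢⇒< (≤-pred fw) q))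
    ...   | φ'' , inj'' , mono'' = φ'' , inj'' , λ u w e p q →
      mono'' u w e (subst (f u <_) (+-suc i j) p) (subst (f w <_) (+-suc i j) q)

    -- Start with any injection into the innermost set. Class 0 never moves, so the climb begins
    -- with class 1 and `j` storeys serve `j + 1` classes.
    monochromatic-copy : ∀ {j S} → Tower κ j S → n ≤ length S → (∀ u → f u ≤ j) → ∃ Copy
    monochromatic-copy {j} {S} T n≤S f≤j
      with distinct-representatives Fin._≟_ n (λ _ → S) [] (λ _ → Tower-Unique T) (λ _ → n≤S)
    ... | φ , inj , φ∈ , _ with climb 1 T φ inj φ∈ (λ u w e p q → ⊥-elim (proper u w e (trans (n<1⇒n≡0 p) (sym (n<1⇒n≡0 q)))))
    ...   | φ' , inj' , mono = φ' , inj' , inj₁ (κ , λ u w e → mono u w e (s≤s (f≤j u)) (s≤s (f≤j w)))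

  -- A colour is represented by a vertex `x` at which it occurs, which keeps the search finite.
  popular? : (S : List V) (q : ℕ) → Decidable (λ v → Any (λ x → length S ≤ q * # (λ y → c v y ≟ c v x) S) S)
  popular? S q v = Any.any? (λ x → length S ≤? q * # (λ y → c v y ≟ c v x) S) S

  favourite : List V → ℕ → V → ℕ
  favourite S q v with popular? S q v
  ... | yes p = c v (proj₁ (find p))
  ... | no _ = 0

  popular : List V → ℕ → List V
  popular S q = filter (popular? S q) S

  popular⊆ : ∀ S q → popular S q ⊆ S
  popular⊆ S q v∈ = proj₁ (∈-filter⁻ (popular? S q) {xs = S} v∈)

  favourite-frequent : ∀ S q {v} → v ∈ popular S q → length S ≤ q * # (λ y → c v y ≟ favourite S q v) S
  favourite-frequent S q {v} v∈ with popular? S q v | proj₂ (∈-filter⁻ (popular? S q) {xs = S} v∈)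
  ... | yes p | _ = proj₂ (proj₂ (find p))
  ... | no ¬p | p = ⊥-elim (¬p p)

  -- The colours not tested by `popular?` are those that `v` does not send into `S`; they have
  -- frequency zero, which is below the length of the non-empty `S`.
  unpopular : ∀ S q → 0 < length S → ∀ {v} → ¬ Any (λ x → length S ≤ q * # (λ y → c v y ≟ c v x) S) S →
    ∀ κ → q * # (λ y → c v y ≟ κ) S < length S
  unpopular S q 0<S {v} ¬p κ with Any.any? (λ x → c v x ≟ κ) S
  ... | yes a with find a
  ...   | x , x∈ , refl = ≰⇒> λ h → ¬p (lose x∈ h)
  unpopular S q 0<S {v} ¬p κ | no ¬a = subst (_< length S) (sym (trans (cong (q *_) none) (*-zeroʳ q))) 0<S
    where
    none : # (λ y → c v y ≟ κ) S ≡ 0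
    none with filter (λ y → c v y ≟ κ) S in eq
    ... | [] = refl
    ... | y ∷ _ with ∈-filter⁻ (λ y → c v y ≟ κ) {xs = S} (subst (y ∈_) (sym eq) (here refl))
    ...   | y∈ , p = ⊥-elim (¬a (lose y∈ p))

  -- If fewer than half of the vertices are popular, the unpopular ones form at least half of `S`.
  -- Restricting to them at most doubles relative frequencies, hence the threshold `2 * q` for a
  -- density of 1/q.
  rainbow-or-popular : ∀ S q → n ^ 4 < q → 0 < length S → ∃ Copy ⊎ length S ≤ 2 * length (popular S (2 * q))
  rainbow-or-popular S q n⁴<q 0<S = split (length S ≤? 2 * length (popular S (2 * q)))
    where
    open ≤-Reasoning
    L = filter (¬? ∘ popular? S (2 * q)) S
    module _ (few : 2 * length (popular S (2 * q)) ≤ length S) where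
      S≤2L : length S ≤ 2 * length L
      S≤2L = +-cancelˡ-≤ (length S) _ _ (begin
        length S + length S                                    ≡⟨ cong (length S +_) (+-identityʳ (length S)) ⟨
        2 * length S                                           ≡⟨ cong (2 *_) (#-complement (popular? S (2 * q)) S) ⟨
        2 * (length (popular S (2 * q)) + length L)            ≡⟨ *-distribˡ-+ 2 (length (popular S (2 * q))) _ ⟩
        2 * length (popular S (2 * q)) + 2 * length L          ≤⟨ +-monoˡ-≤ _ few ⟩
        length S + 2 * length L                                ∎)
      sparse : ∀ {v} κ → v ∈ L → q * # (λ x → c v x ≟ κ) L ≤ length L
      sparse {v} κ v∈ = *-cancelˡ-≤ 2 (begin
        2 * (q * # (λ x → c v x ≟ κ) L)  ≡⟨ *-assoc 2 q _ ⟨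
        2 * q * # (λ x → c v x ≟ κ) L    ≤⟨ *-monoʳ-≤ (2 * q) (#-filter (λ x → c v x ≟ κ) (¬? ∘ popular? S (2 * q)) S) ⟩
        2 * q * # (λ x → c v x ≟ κ) S    ≤⟨ <⇒≤ (unpopular S (2 * q) 0<S (proj₂ (∈-filter⁻ (¬? ∘ popular? S (2 * q)) {xs = S} v∈)) κ) ⟩
        length S                         ≤⟨ S≤2L ⟩
        2 * length L                     ∎)
      0<L : 0 < length L
      0<L = *-cancelˡ-< 2 0 _ (<-≤-trans 0<S S≤2L)
      rainbow : ∃ Copy
      rainbow = let φ , inj , rb = rainbow-copy c c-sym H L q sparse n⁴<q 0<L in φ , inj , inj₂ (inj₁ rb)
    split : Dec (length S ≤ 2 * length (popular S (2 * q))) → ∃ Copy ⊎ length S ≤ 2 * length (popular S (2 * q))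
    split (yes p) = inj₂ p
    split (no ¬p) = inj₁ (rainbow (≰⇒≥ ¬p))

  record Favourites (S : List V) (q : ℕ) : Set where
    field
      colour   : V → ℕ
      support  : List V
      support⊆ : support ⊆ S
      unique   : Unique support
      small    : length support ≤ length S
      half     : length S ≤ 2 * length support
      frequent : ∀ {v} → v ∈ support → length S ≤ q * # (λ y → c v y ≟ colour v) S

  rainbow-or-favourites : ∀ {S} q → Unique S → n ^ 4 < q → 0 < length S → ∃ Copy ⊎ Favourites S (2 * q)
  rainbow-or-favourites {S} q uniq n⁴<q 0<S = map₂ (λ S≤2P → record
    { colour   = favourite S (2 * q)
    ; support  = popular S (2 * q)
    ; support⊆ = popular⊆ S (2 * q)
    ; unique   = filter⁺ (popular? S (2 * q)) uniq
    ; small    = length-filter (popular? S (2 * q)) S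
    ; half     = S≤2P
    ; frequent = favourite-frequent S (2 * q)
    }) (rainbow-or-popular S q n⁴<q 0<S)

  -- Upper bound for bipartite graphs

  module Bipartite (f : Fin n → Fin 2) (proper : ∀ u w → Edge H u w → f u ≢ f w)
    (κ : V → ℕ) (A : List V) (uniq : Unique A)
    (rich : Rich H regular (λ v w → c v w ≟ κ v) A (allFin N)) where

    -- On the fibre of `κ x` the relation "joined in the favourite colour of `v`" is adjacency in
    -- one fixed colour, so the fibre is a storey over the whole vertex set.
    constant-case : ∀ x → n ≤ # (λ y → κ y ≟ κ x) A → ∃ Copy
    constant-case x n≤ = monochromatic-copy (toℕ ∘ f) (λ u w e → proper u w e ∘ Fin.toℕ-injective)
      (step (base (allFin⁺ N)) (filter⁺ same? uniq) (λ _ → ∈-allFin _) rich')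
      n≤ (λ u → ≤-pred (Fin.toℕ<n (f u)))
      where
      same? : Decidable (λ v → κ v ≡ κ x)
      same? v = κ v ≟ κ x
      rich' : Rich H regular (colour? (κ x)) (filter same? A) (allFin N)
      rich' Q len Q⊆ = <-≤-trans (rich Q len (proj₁ ∘ ∈-filter⁻ same? {xs = A} ∘ Q⊆))
        (#-mono (joint? _ Q) (joint? (colour? (κ x)) Q) (allFin N) λ _ h →
          All.tabulate λ v∈ → trans (All.lookup h v∈) (proj₂ (∈-filter⁻ same? {xs = A} (Q⊆ v∈))))

    -- Class 0 stays at `ψ` and class 1 moves to common neighbours, so that each `u` of class 0
    -- sends only its favourite colour. Ordering by the pair of class and vertex puts class 0 first.
    injective-case : (ψ : Fin n → V) → Injective _≡_ _≡_ (κ ∘ ψ) → (∀ i → ψ i ∈ A) → ∃ Copy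
    injective-case ψ κψ-inj ψ∈
      with re-embed H regular (λ v w → c v w ≟ κ v) rich (allFin⁺ N) ψ (λ eq → κψ-inj (cong κ eq)) ψ∈ (λ u → f u Fin.≟ suc zero)
         | rank (λ u → toℕ (combine (f u) u)) (λ {u} {w} eq → proj₂ (Fin.combine-injective (f u) u (f w) w (Fin.toℕ-injective eq)))
    ... | φ , inj , stay , move | pos , pos-inj , pos-mono =
      -- Vertices of class 1 have no forward edges, so any colours distinct from the others can be
      -- assigned to them; `κ ∘ ψ` provides such colours.
      φ , inj , inj₂ (inj₂ (pos , pos-inj , κ ∘ ψ , κψ-inj , λ u w e lt → forward u w e lt (f u) (f w) refl refl))
      where
      forward : ∀ u w → Edge H u w → toℕ (pos u) < toℕ (pos w) → ∀ a b → f u ≡ a → f w ≡ b → c (φ u) (φ w) ≡ κ (ψ u)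
      forward u w e lt zero zero fu fw = ⊥-elim (proper u w e (trans fu (sym fw)))
      forward u w e lt (suc zero) (suc zero) fu fw = ⊥-elim (proper u w e (trans fu (sym fw)))
      forward u w e lt zero (suc zero) fu fw =
        trans (cong (λ z → c z (φ w)) (stay u (λ p → Fin.0≢1+n (trans (sym fu) p))))
          (proj₂ (move w fw) u (trans (adj-sym H w u) e))
      forward u w e lt (suc zero) zero fu fw = ⊥-elim (<-asym (pos-mono u w lt)
        (Fin.combine-monoˡ-< w u (subst₂ Data.Fin._<_ (sym fw) (sym fu) (s≤s z≤n))))

    copy : 0 < n → n * n ≤ length A → ∃ Copy
    copy 0<n large = [ (λ { (x , n≤) → constant-case x n≤ }) , (λ { (ψ , inj , ψ∈) → injective-case ψ inj ψ∈ }) ]′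
      (constant-or-injective n n 0<n κ A large)

  bipartite-copy : Colorable H 2 → 0 < n → ∀ q → n ^ 4 < q → n + n ≤ 2 * q →
    2 * ((2 * q) ^ (2 + d) * suc (n * n)) < N → ∃ Copy
  bipartite-copy (f , proper) 0<n q n⁴<q 2n≤2q large =
    [ id , from-favourites ]′ (rainbow-or-favourites q (allFin⁺ N) n⁴<q
      (subst (0 <_) (sym (length-allFin N)) (≤-<-trans z≤n large)))
    where
    from-favourites : Favourites (allFin N) (2 * q) → ∃ Copy
    from-favourites F =
      let A , A⊆P , uniq , n²<A , rich =
            dependent-random-choice (λ v w → c v w ≟ colour v) support (allFin N) d (n + n) (2 * q) (n * n)
              frequent small 2n≤2q
              (*-cancelˡ-< 2 _ _ (<-≤-trans large (subst (_≤ 2 * length support) (length-allFin N) half)))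
      in Bipartite.copy f proper colour A (uniq unique) rich 0<n (<⇒≤ n²<A)
      where open Favourites F

-- Upper bound for general chromatic number

module General {N n d : ℕ} (H : Graph n) (regular : Regular H d)
  (c : Fin N → Fin N → ℕ) (c-sym : ∀ i j → c i j ≡ c j i)
  {j : ℕ} (f : Fin n → Fin (suc j)) (proper : ∀ u w → Edge H u w → f u ≢ f w)
  (0<n : 0 < n) (q : ℕ) (n⁴<q : n ^ 4 < q) (2n≤2q : n + n ≤ 2 * q) where

  open Upper H regular c c-sym

  -- The second component of (v , κ) is the colour of all edges from v to the later vertices;
  -- the latest vertex comes first.
  Later : V × ℕ → V × ℕ → Set
  Later (v , κ) (v' , κ') = c v' v ≡ κ' × κ ≢ κ'

  Star : List V → V × ℕ → Set
  Star S (v , κ) = ∀ x → x ∈ S → c v x ≡ κ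

  opposite-reverses : ∀ {m} (u w : Fin m) → toℕ (opposite u) < toℕ (opposite w) → toℕ w < toℕ u
  opposite-reverses {m} u w lt = ≰⇒> λ u≤w → <⇒≱ lt
    (subst₂ _≤_ (sym (Fin.opposite-prop w)) (sym (Fin.opposite-prop u)) (∸-monoʳ-≤ m (s≤s u≤w)))

  -- The list begins with the latest vertex, so `opposite` restores the order of choice.
  lexicographic-copy : ∀ {S ls} → 0 < length S → All (Star S) ls → AllPairs Later ls → n ≤ length ls → ∃ Copy
  lexicographic-copy {[]} () 
  lexicographic-copy {x ∷ S} {ls} 0<S stars later n≤ = φ , φ-inj , inj₂ (inj₂ (opposite , pos-inj , col , col-inj , forward))
    where
    e : Fin n → Fin (length ls)
    e u = inject≤ u n≤
    φ : Fin n → V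
    φ u = proj₁ (lookup ls (e u))
    col : Fin n → ℕ
    col u = proj₂ (lookup ls (e u))
    related : ∀ u w → toℕ u < toℕ w → Later (lookup ls (e u)) (lookup ls (e w))
    related u w lt = AllPairs-lookup later (e u) (e w)
      (subst₂ _<_ (sym (Fin.toℕ-inject≤ u n≤)) (sym (Fin.toℕ-inject≤ w n≤)) lt)
    col-inj : Injective _≡_ _≡_ col
    col-inj {u} {w} eq with Fin.<-cmp u w
    ... | tri< lt _ _ = ⊥-elim (proj₂ (related u w lt) eq)
    ... | tri≈ _ p _ = p
    ... | tri> _ _ gt = ⊥-elim (proj₂ (related w u gt) (sym eq))
    -- The colour of an entry can be read off its vertex as the colour of the edge to the remaining
    -- vertex `x`. Distinct colours therefore force distinct vertices.
    φ-inj : Injective _≡_ _≡_ φ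
    φ-inj {u} {w} eq = col-inj (trans (sym (star u)) (trans (cong (λ v → c v x) eq) (star w)))
      where
      star : ∀ u → c (φ u) x ≡ col u
      star u = All.lookup stars (∈-lookup {xs = ls} (e u)) x (here refl)
    pos-inj : Injective _≡_ _≡_ opposite
    pos-inj {u} {w} eq = trans (sym (Fin.opposite-involutive u)) (trans (cong opposite eq) (Fin.opposite-involutive w))
    forward : ∀ u w → Edge H u w → toℕ (opposite u) < toℕ (opposite w) → c (φ u) (φ w) ≡ col u
    forward u w _ lt = proj₁ (related w u (opposite-reverses u w lt))

  -- `Q` is the popularity threshold. In `loss`, the factor `2 * n` pays for the popular half and
  -- for the share of one old colour in it, `Q ^ (2 + d)` for dependent random choice, and the last
  -- 2 for replacing `suc Y` by `2 * Y`.
  Q loss : ℕ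
  Q = 2 * q
  loss = 2 * n * (Q ^ (2 + d) * 2)

  -- `budget` measures progress: a step spends one unit of fuel and raises the sum of one plus the
  -- tower height over the sequence by at least one. `large` reserves a factor `loss` for every step
  -- still to come.
  record State (fuel : ℕ) : Set where
    field
      S        : List V
      sequence : List (V × ℕ)
      height   : ℕ → ℕ
      unique   : Unique S
      large    : loss ^ fuel * n ≤ length S
      stars    : All (Star S) sequence
      later    : AllPairs Later sequence
      towers   : ∀ κ → Tower κ (height κ) S
      budget   : suc j * n ≤ fuel + ∑[ e ∈ sequence ] suc (height (proj₂ e))

  Q≥1 : 1 ≤ Q
  Q≥1 = ≤-trans (≤-trans 0<n (m≤m+n n n)) 2n≤2q

  Q≤Qᵗ : Q ≤ Q ^ (2 + d)
  Q≤Qᵗ = m≤m*n Q (Q ^ (1 + d)) {{>-nonZero (m^n>0 Q {{>-nonZero Q≥1}} (1 + d))}}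

  Q≤loss : Q ≤ loss
  Q≤loss = begin
    Q                                  ≤⟨ Q≤Qᵗ ⟩
    Q ^ (2 + d)                        ≤⟨ m≤m*n (Q ^ (2 + d)) 2 ⟩
    Q ^ (2 + d) * 2                    ≤⟨ m≤n*m (Q ^ (2 + d) * 2) (2 * n) {{>-nonZero (≤-trans 0<n (m≤m+n n (n + 0)))}} ⟩
    loss                                  ∎
    where open ≤-Reasoning

  n≤lossᵏ*n : ∀ k → n ≤ loss ^ k * n
  n≤lossᵏ*n k = m≤n*m n (loss ^ k) {{>-nonZero (m^n>0 loss {{>-nonZero (≤-trans Q≥1 Q≤loss)}} k)}}

  module _ {k : ℕ} (st : State k) where
    open State st

    n≤S : n ≤ length S
    n≤S = ≤-trans (n≤lossᵏ*n k) large

    -- A sequence of `n` entries is a lexicographic copy, and a tower of `j` storeys contains a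
    -- monochromatic one; otherwise both quantities are bounded.
    stuck-or-copy : ∃ Copy ⊎ (length sequence < n × (∀ {e} → e ∈ sequence → height (proj₂ e) < j))
    stuck-or-copy with n ≤? length sequence
    ... | yes p = inj₁ (lexicographic-copy (≤-trans 0<n n≤S) stars later p)
    ... | no ¬p with Any.any? (λ e → j ≤? height (proj₂ e)) sequence
    ...   | yes a = let (_ , κ) , _ , j≤ = find a in
            inj₁ (monochromatic-copy (toℕ ∘ f) (λ u w e → proper u w e ∘ Fin.toℕ-injective) (towers κ) n≤S
              (λ u → ≤-trans (≤-pred (Fin.toℕ<n (f u))) j≤))
    ...   | no ¬a = inj₂ (≰⇒> ¬p , λ e∈ → ≰⇒> (¬a ∘ lose e∈))

  -- Without fuel the budget requires a sum of at least `suc j * n`, but fewer than `n` entries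
  -- contribute at most `j` each.
  final : State 0 → ∃ Copy
  final st = [ id , (λ { (short , low) → ⊥-elim (<⇒≱ (bound short low) budget) }) ]′ (stuck-or-copy st)
    where
    open State st
    bound : length sequence < n → (∀ {e} → e ∈ sequence → height (proj₂ e) < j) →
      ∑[ e ∈ sequence ] suc (height (proj₂ e)) < suc j * n
    bound short low = begin-strict
      ∑[ e ∈ sequence ] suc (height (proj₂ e)) ≤⟨ ∑-mono sequence low ⟩
      ∑[ e ∈ sequence ] j                      ≡⟨ ∑-const sequence j ⟩
      length sequence * j                      ≤⟨ *-monoˡ-≤ j (<⇒≤ short) ⟩
      n * j                                    ≡⟨ *-comm n j ⟩
      j * n                                    <⟨ +-monoˡ-≤ (j * n) 0<n ⟩
      suc j * n                                ∎
      where open ≤-Reasoning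

  module _ {k : ℕ} (st : State (suc k)) where
    open State st
    open ≤-Reasoning

    private
      Y = loss ^ k * n

      loss*Y≤S : loss * Y ≤ length S
      loss*Y≤S = ≤-trans (≤-reflexive (sym (*-assoc loss (loss ^ k) n))) large

    -- Passing to the neighbourhood of `v` in colour `κ` makes `v` a star over the new set. The old
    -- entries were stars over `S`, which contains `v`, so they precede it correctly.
    extend-sequence : ∀ v κ → v ∈ S → All (λ e → κ ≢ proj₂ e) sequence → length S ≤ Q * # (λ y → c v y ≟ κ) S → State k
    extend-sequence v κ v∈ new dense = record
      { S        = S'
      ; sequence = (v , κ) ∷ sequence
      ; height   = height
      ; unique   = unique'
      ; large    = *-cancelˡ-≤ Q {{>-nonZero Q≥1}} (≤-trans (*-monoˡ-≤ Y Q≤loss) (≤-trans loss*Y≤S dense))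
      ; stars    = (λ x x∈ → proj₂ (∈-filter⁻ (λ y → c v y ≟ κ) {xs = S} x∈)) ∷ All.map (λ star x x∈ → star x (S'⊆S x∈)) stars
      ; later    = All.zipWith (λ { (star , κ≢) → star v v∈ , κ≢ }) (stars , new) ∷ later
      ; towers   = λ κ' → Tower-⊆ unique' S'⊆S (towers κ')
      ; budget   = begin
          suc j * n                                                     ≤⟨ budget ⟩
          suc k + ∑[ e ∈ sequence ] suc (height (proj₂ e))              ≡⟨ +-suc k _ ⟨
          k + suc (∑[ e ∈ sequence ] suc (height (proj₂ e)))            ≤⟨ +-monoʳ-≤ k (+-monoˡ-≤ _ (s≤s z≤n)) ⟩
          k + (suc (height κ) + ∑[ e ∈ sequence ] suc (height (proj₂ e))) ∎
      }
      where
      S' = filter (λ y → c v y ≟ κ) S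
      S'⊆S : S' ⊆ S
      S'⊆S x∈ = proj₁ (∈-filter⁻ (λ y → c v y ≟ κ) {xs = S} x∈)
      unique' = filter⁺ (λ y → c v y ≟ κ) unique

    -- Only the tower of `κ` grows; the others are restricted to the smaller set. The budget gains
    -- because `κ` occurs in the sequence.
    raise-tower : ∀ {v κ} → (v , κ) ∈ sequence → ∀ {S'} → S' ⊆ S → Unique S' → Y ≤ length S' →
      Rich H regular (colour? κ) S' S → State k
    raise-tower {v} {κ} e∈ {S'} S'⊆S unique' Y≤ rich = record
      { S        = S'
      ; sequence = sequence
      ; height   = λ κ' → 𝟙 (κ' ≟ κ) + height κ'
      ; unique   = unique'
      ; large    = Y≤
      ; stars    = All.map (λ star x x∈ → star x (S'⊆S x∈)) stars
      ; later    = later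
      ; towers   = raised
      ; budget   = begin
          suc j * n                                                                       ≤⟨ budget ⟩
          suc k + ∑[ e ∈ sequence ] suc (height (proj₂ e))                                ≡⟨ +-suc k _ ⟨
          k + suc (∑[ e ∈ sequence ] suc (height (proj₂ e)))                              ≤⟨ +-monoʳ-≤ k (∑-<-strict sequence
                                                                                              (λ e → s≤s (m≤n+m _ (𝟙 (proj₂ e ≟ κ)))) e∈
                                                                                              (s≤s (+-monoˡ-≤ (height κ) (≤-reflexive (sym (𝟙-yes (κ ≟ κ) refl)))))) ⟩
          k + ∑[ e ∈ sequence ] suc (𝟙 (proj₂ e ≟ κ) + height (proj₂ e))                  ∎
      }
      where
      raised : ∀ κ' → Tower κ' (𝟙 (κ' ≟ κ) + height κ') S'
      raised κ' = by-equality (κ' ≟ κ)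
        where
        by-equality : (eq? : Dec (κ' ≡ κ)) → Tower κ' (𝟙 eq? + height κ') S'
        by-equality (yes refl) = step (towers κ) unique' S'⊆S rich
        by-equality (no _)     = Tower-⊆ unique' S'⊆S (towers κ')

    -- Dependent random choice is applied to the vertices with favourite colour `κ`. Each of them
    -- has many neighbours in that colour in `S`, so the outcome is a new storey over `S`.
    choose-tower : (F : Favourites S Q) → let open Favourites F using (support; colour) in
      ∀ {v κ} → (v , κ) ∈ sequence → length support < n * # (λ v → colour v ≟ κ) support → State k
    choose-tower F {v} {κ} e∈ many =
      let A , A⊆P , uniq , Y<A , rich = dependent-random-choice (colour? κ) P S d (n + n) Q Y
            dense (≤-trans (length-filter same? support) small) 2n≤2q P-large
      in raise-tower e∈ (λ x∈ → support⊆ (proj₁ (∈-filter⁻ same? {xs = support} (A⊆P x∈))))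
           (uniq (filter⁺ same? (Favourites.unique F))) (<⇒≤ Y<A) rich
      where
      open Favourites F hiding (unique)
      same? : Decidable (λ v → colour v ≡ κ)
      same? v = colour v ≟ κ
      P = filter same? support
      dense : ∀ {v} → v ∈ P → length S ≤ Q * # (colour? κ v) S
      dense {v} v∈ with ∈-filter⁻ same? {xs = support} v∈
      ... | v∈' , refl = frequent v∈'
      P-large : Q ^ (2 + d) * suc Y < length P
      P-large = *-cancelˡ-< (2 * n) _ _ (begin-strict
        2 * n * (Q ^ (2 + d) * suc Y)      ≤⟨ *-monoʳ-≤ (2 * n) (*-monoʳ-≤ (Q ^ (2 + d)) (≤-trans (+-monoˡ-≤ Y (≤-trans 0<n (n≤lossᵏ*n k))) (≤-reflexive (cong (Y +_) (sym (+-identityʳ Y)))))) ⟩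
        2 * n * (Q ^ (2 + d) * (2 * Y))    ≡⟨ cong (2 * n *_) (*-assoc (Q ^ (2 + d)) 2 Y) ⟨
        2 * n * (Q ^ (2 + d) * 2 * Y)      ≡⟨ *-assoc (2 * n) (Q ^ (2 + d) * 2) Y ⟨
        loss * Y                              ≤⟨ loss*Y≤S ⟩
        length S                           ≤⟨ half ⟩
        2 * length support                 <⟨ *-monoʳ-< 2 many ⟩
        2 * (n * length P)                 ≡⟨ *-assoc 2 n (length P) ⟨
        2 * n * length P                   ∎)

    advance : ∃ Copy ⊎ State k
    advance = [ inj₁ , (λ { (short , _) → map₂ (from-favourites short) (rainbow-or-favourites q unique n⁴<q 0<S) }) ]′ (stuck-or-copy st)
      where
      0<S = ≤-trans 0<n (n≤S st)
      from-favourites : length sequence < n → Favourites S Q → State k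
      from-favourites short F = by-colour (Any.any? (λ e → length support <? n * # (λ v → colour v ≟ proj₂ e) support) sequence)
        where
        open Favourites F hiding (unique)
        by-colour : Dec (Any (λ e → length support < n * # (λ v → colour v ≟ proj₂ e) support) sequence) → State k
        by-colour (yes a) = let (v , κ) , e∈ , many = find a in choose-tower F e∈ many
        by-colour (no ¬a) =
          -- Fewer than `n` old colours, each the favourite of at most a 1/n share of the support,
          -- cannot cover it: some vertex has a new favourite colour.
          let v , v∈ , new = union-bound (λ e v → colour v ≟ proj₂ e) support sequence n
                (λ e∈ → ≮⇒≥ (¬a ∘ lose e∈)) short
                (*-cancelˡ-< 2 0 _ (<-≤-trans 0<S half))
          in extend-sequence v (colour v) (support⊆ v∈) (All.tabulate new) (frequent v∈)

  run : ∀ k → State k → ∃ Copy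
  run zero st = final st
  run (suc k) st = [ id , run k ]′ (advance st)

  copy : loss ^ (suc j * n) * n ≤ N → ∃ Copy
  copy large = run (suc j * n) record
    { S        = allFin N
    ; sequence = []
    ; height   = λ _ → 0
    ; unique   = allFin⁺ N
    ; large    = ≤-trans large (≤-reflexive (sym (length-allFin N)))
    ; stars    = []
    ; later    = []
    ; towers   = λ _ → base (allFin⁺ N)
    ; budget   = m≤m+n _ _
    }

-- Decidability and existence of the Erdős–Rado number

-- Functions are searched through their tables of values; a function agrees with its table only
-- pointwise, hence the invariance hypothesis.
∃-function? : ∀ {n m} {P : (Fin n → Fin m) → Set} → (∀ {f g} → (∀ i → f i ≡ g i) → P f → P g) →
  (∀ f → Dec (P f)) → Dec (∃ P)
∃-function? {n} {m} resp P? = map′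
  (λ a → let v , _ , p = find a in lookupᵛ v , p)
  (λ { (f , p) → lose (∈-vecs⁺ (tabulateᵛ f) (λ _ → ∈-allFin _)) (resp (λ i → sym (lookup∘tabulate f i)) p) })
  (Any.any? (P? ∘ lookupᵛ) (vecs n (allFin m)))

∀-function? : ∀ {n m} {P : (Fin n → Fin m) → Set} → (∀ {f g} → (∀ i → f i ≡ g i) → P f → P g) →
  (∀ f → Dec (P f)) → Dec (∀ f → P f)
∀-function? resp P? = map′
  (λ ¬∃ f → decidable-stable (P? f) (λ ¬p → ¬∃ (f , ¬p)))
  (λ { h (f , ¬p) → ¬p (h f) })
  (¬? (∃-function? (λ eq ¬p p → ¬p (resp (sym ∘ eq) p)) (¬? ∘ P?)))

injective? : ∀ {n m} (f : Fin n → Fin m) → Dec (Injective _≡_ _≡_ f)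
injective? f = map′ (λ h {u} {w} → h u w) (λ h u w → h {u} {w})
  (Fin.all? λ u → Fin.all? λ w → (f u Fin.≟ f w) →-dec (u Fin.≟ w))

module _ {n : ℕ} (H : Graph n) where

  edge? : ∀ u v → Dec (Edge H u v)
  edge? u v = adj H u v Bool.≟ true

  Matrix : Set
  Matrix = Fin n → Fin n → ℕ

  Mono Rain : Matrix → Set
  Mono e = ∀ u v u' v' → Edge H u v → Edge H u' v' → e u v ≡ e u' v'
  Rain e = ∀ u v u' v' → Edge H u v → Edge H u' v' → e u v ≡ e u' v' → (u ≡ u' × v ≡ v') ⊎ (u ≡ v' × v ≡ u')

  -- Two forward edges have the same colour exactly when they start at the same vertex; this
  -- replaces the choice of the colours of the vertices.
  LexBy : Matrix → (Fin n → Fin n) → Set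
  LexBy e pos = Injective _≡_ _≡_ pos × (∀ u v u' v' → Edge H u v → Edge H u' v' →
    toℕ (pos u) < toℕ (pos v) → toℕ (pos u') < toℕ (pos v') → (u ≡ u' → e u v ≡ e u' v') × (e u v ≡ e u' v' → u ≡ u'))

  -- Canonicity in terms of the equalities between colours only, which makes it decidable.
  Canon : Matrix → Set
  Canon e = Mono e ⊎ Rain e ⊎ ∃ (LexBy e)

  SamePattern : Matrix → Matrix → Set
  SamePattern e e' = ∀ u v u' v' → (e u v ≡ e u' v' → e' u v ≡ e' u' v') × (e' u v ≡ e' u' v' → e u v ≡ e u' v')

  Canon-resp : ∀ {e e'} → SamePattern e e' → Canon e → Canon e'
  Canon-resp same (inj₁ mono) = inj₁ λ u v u' v' p q → proj₁ (same u v u' v') (mono u v u' v' p q)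
  Canon-resp same (inj₂ (inj₁ rain)) = inj₂ (inj₁ λ u v u' v' p q → rain u v u' v' p q ∘ proj₂ (same u v u' v'))
  Canon-resp same (inj₂ (inj₂ (pos , inj , lex))) = inj₂ (inj₂ (pos , inj , λ u v u' v' p q lt lt' →
    proj₁ (same u v u' v') ∘ proj₁ (lex u v u' v' p q lt lt') , proj₂ (lex u v u' v' p q lt lt') ∘ proj₂ (same u v u' v')))

  LexBy-resp : ∀ {e f g} → (∀ i → f i ≡ g i) → LexBy e f → LexBy e g
  LexBy-resp {e} {f} {g} eq (inj , lex) =
    (λ {u} {w} p → inj (trans (eq u) (trans p (sym (eq w))))) ,
    λ u v u' v' p q lt lt' → lex u v u' v' p q (back u v lt) (back u' v' lt')
    where
    back : ∀ u v → toℕ (g u) < toℕ (g v) → toℕ (f u) < toℕ (f v)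
    back u v = subst₂ (λ x y → toℕ x < toℕ y) (sym (eq u)) (sym (eq v))

  canon? : ∀ e → Dec (Canon e)
  canon? e =
    (Fin.all? λ u → Fin.all? λ v → Fin.all? λ u' → Fin.all? λ v' →
      edge? u v →-dec (edge? u' v' →-dec (e u v ≟ e u' v'))) ⊎-dec
    ((Fin.all? λ u → Fin.all? λ v → Fin.all? λ u' → Fin.all? λ v' →
      edge? u v →-dec (edge? u' v' →-dec ((e u v ≟ e u' v') →-dec
        (((u Fin.≟ u') ×-dec (v Fin.≟ v')) ⊎-dec ((u Fin.≟ v') ×-dec (v Fin.≟ u')))))) ⊎-dec
    ∃-function? LexBy-resp λ pos → injective? pos ×-dec
      (Fin.all? λ u → Fin.all? λ v → Fin.all? λ u' → Fin.all? λ v' →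
        edge? u v →-dec (edge? u' v' →-dec ((toℕ (pos u) <? toℕ (pos v)) →-dec ((toℕ (pos u') <? toℕ (pos v')) →-dec
          (((u Fin.≟ u') →-dec (e u v ≟ e u' v')) ×-dec ((e u v ≟ e u' v') →-dec (u Fin.≟ u'))))))))

  module _ {N : ℕ} (c : Fin N → Fin N → ℕ) (φ : Fin n → Fin N) where

    Canonical⇒Canon : Canonical H c φ → Canon (ecol H c φ)
    Canonical⇒Canon (inj₁ (κ , mono)) = inj₁ λ u v u' v' p q → trans (mono u v p) (sym (mono u' v' q))
    Canonical⇒Canon (inj₂ (inj₁ rainbow)) = inj₂ (inj₁ rainbow)
    Canonical⇒Canon (inj₂ (inj₂ (pos , inj , col , col-inj , lex))) = inj₂ (inj₂ (pos , inj , λ u v u' v' p q lt lt' →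
      (λ u≡u' → trans (lex u v p lt) (trans (cong col u≡u') (sym (lex u' v' q lt')))) ,
      (λ eq → col-inj (trans (sym (lex u v p lt)) (trans eq (lex u' v' q lt'))))))

    Canon⇒Canonical : Canon (ecol H c φ) → Canonical H c φ
    Canon⇒Canonical (inj₂ (inj₁ rainbow)) = inj₂ (inj₁ rainbow)
    Canon⇒Canonical (inj₁ mono) = inj₁ (monochromatic (Fin.any? λ u → Fin.any? λ v → edge? u v))
      where
      monochromatic : Dec (∃ λ u → ∃ λ v → Edge H u v) → Monochromatic H c φ
      monochromatic (yes (u , v , p)) = ecol H c φ u v , λ u' v' q → mono u' v' u v q p
      -- Without edges any colour will do.
      monochromatic (no ¬p) = 0 , λ u v p → ⊥-elim (¬p (u , v , p))
    Canon⇒Canonical (inj₂ (inj₂ (pos , inj , lex))) = inj₂ (inj₂ (pos , inj , col , col-inj , col-spec))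
      where
      e = ecol H c φ
      Forward : Fin n → Set
      Forward u = ∃ λ v → Edge H u v × toℕ (pos u) < toℕ (pos v)
      forward? : ∀ u → Dec (Forward u)
      forward? u = Fin.any? λ v → edge? u v ×-dec (toℕ (pos u) <? toℕ (pos v))
      M = suc (∑[ u ∈ allFin n ] ∑[ v ∈ allFin n ] e u v)
      e<M : ∀ u v → e u v < M
      e<M u v = s≤s (≤-trans (∑-∈ (allFin n) (e u) (∈-allFin v)) (∑-∈ (allFin n) (λ u → ∑[ v ∈ allFin n ] e u v) (∈-allFin u)))
      -- Vertices without forward edges receive colours that do not occur elsewhere.
      colour : ∀ u → Dec (Forward u) → ℕ
      colour u (yes (v , _)) = e u v
      colour u (no _) = M + toℕ u
      col : Fin n → ℕ
      col u = colour u (forward? u)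
      colour-inj : ∀ {u u'} (d : Dec (Forward u)) (d' : Dec (Forward u')) → colour u d ≡ colour u' d' → u ≡ u'
      colour-inj {u} {u'} (yes (v , p , lt)) (yes (v' , q , lt')) eq = proj₂ (lex u v u' v' p q lt lt') eq
      colour-inj {u} {u'} (yes (v , _)) (no _) eq = ⊥-elim (<⇒≢ (<-≤-trans (e<M u v) (m≤m+n M (toℕ u'))) eq)
      colour-inj {u} {u'} (no _) (yes (v , _)) eq = ⊥-elim (<⇒≢ (<-≤-trans (e<M u' v) (m≤m+n M (toℕ u))) (sym eq))
      colour-inj (no _) (no _) eq = Fin.toℕ-injective (+-cancelˡ-≡ M _ _ eq)
      col-inj : Injective _≡_ _≡_ col
      col-inj {u} {u'} = colour-inj (forward? u) (forward? u')
      colour-spec : ∀ u w → Edge H u w → toℕ (pos u) < toℕ (pos w) → (d : Dec (Forward u)) → e u w ≡ colour u d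
      colour-spec u w p lt (yes (v , q , lt')) = proj₁ (lex u w u v p q lt lt') refl
      colour-spec u w p lt (no ¬f) = ⊥-elim (¬f (w , p , lt))
      col-spec : ∀ u w → Edge H u w → toℕ (pos u) < toℕ (pos w) → e u w ≡ col u
      col-spec u w p lt = colour-spec u w p lt (forward? u)

  -- At most `N * N` colours occur on the pairs, and one further value serves as a default. A
  -- colouring becomes a function between finite sets, so all of them can be searched.
  FiniteArrows : ℕ → Set
  FiniteArrows N = ∀ (W : Fin (N * N) → Fin (suc (N * N))) →
    (∀ (i j : Fin N) → W (combine i j) ≡ W (combine j i)) →
    ∃ λ (φ : Fin n → Fin N) → Injective _≡_ _≡_ φ × Canon (λ u v → toℕ (W (combine (φ u) (φ v))))

  finiteArrows? : ∀ N → Dec (FiniteArrows N)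
  finiteArrows? N = ∀-function?
    (λ {f} {g} eq h g-sym →
      let φ , inj , canon = h (λ i j → trans (eq _) (trans (g-sym i j) (sym (eq _))))
      in φ , inj , Canon-resp (λ u v u' v' → pattern-≗ (cong toℕ (eq _)) (cong toℕ (eq _))) canon)
    λ W → (Fin.all? λ (i : Fin N) → Fin.all? λ (j : Fin N) → W (combine i j) Fin.≟ W (combine j i)) →-dec
      ∃-function?
        (λ {f} {g} eq → λ { (inj , canon) →
          (λ {u} {w} p → inj (trans (eq u) (trans p (sym (eq w))))) ,
          Canon-resp (λ u v u' v' → pattern-≗ (cong toℕ (cong₂ (λ i j → W (combine i j)) (eq u) (eq v)))
                                             (cong toℕ (cong₂ (λ i j → W (combine i j)) (eq u') (eq v')))) canon })
        (λ φ → injective? φ ×-dec canon? _)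
    where
    pattern-≗ : ∀ {a b a' b' : ℕ} → a ≡ a' → b ≡ b' → (a ≡ b → a' ≡ b') × (a' ≡ b' → a ≡ b)
    pattern-≗ refl refl = id , id

  Arrows⇒FiniteArrows : ∀ {N} → Arrows N H → FiniteArrows N
  Arrows⇒FiniteArrows {N} arrows W W-sym =
    let φ , inj , canonical = arrows (c , λ i j → cong toℕ (W-sym i j))
    in φ , inj , Canonical⇒Canon c φ canonical
    where
    c : Fin N → Fin N → ℕ
    c i j = toℕ (W (combine i j))

  -- Each colour is renamed after a pair that carries it. The name depends on the colour alone and
  -- determines it, so the pattern of equal colours, and with it canonicity, is preserved.
  FiniteArrows⇒Arrows : ∀ {N} → FiniteArrows N → Arrows N H
  FiniteArrows⇒Arrows {N} arrows (c , c-sym) =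
    let φ , inj , canon = arrows (code ∘ f) (λ i j → cong code (trans (f-combine i j) (trans (c-sym i j) (sym (f-combine j i)))))
    in φ , inj , Canon⇒Canonical c φ (Canon-resp (λ u v u' v' →
         (λ eq → trans (sym (f-combine _ _)) (trans (code-inj _ _ (Fin.toℕ-injective eq)) (f-combine _ _))) ,
         (λ eq → cong (toℕ ∘ code) (trans (f-combine _ _) (trans eq (sym (f-combine _ _)))))) canon)
    where
    f : Fin (N * N) → ℕ
    f x = uncurry c (remQuot {N} N x)
    f-combine : ∀ i j → f (combine i j) ≡ c i j
    f-combine i j = cong (uncurry c) (Fin.remQuot-combine i j)
    code′ : ∀ k → Dec (∃ λ x → f x ≡ k) → Fin (suc (N * N))
    code′ k (yes (x , _)) = suc x
    code′ k (no _) = zero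
    code : ℕ → Fin (suc (N * N))
    code k = code′ k (Fin.any? λ x → f x ≟ k)
    code′-inj : ∀ x y (d : Dec (∃ λ z → f z ≡ f x)) (d' : Dec (∃ λ z → f z ≡ f y)) →
      code′ (f x) d ≡ code′ (f y) d' → f x ≡ f y
    code′-inj x y (yes (a , p)) (yes (b , q)) eq = trans (sym p) (trans (cong f (Fin.suc-injective eq)) q)
    code′-inj x y (no ¬p) _ eq = ⊥-elim (¬p (x , refl))
    code′-inj x y (yes _) (no ¬q) eq = ⊥-elim (¬q (y , refl))
    code-inj : ∀ x y → code (f x) ≡ code (f y) → f x ≡ f y
    code-inj x y = code′-inj x y _ _

  arrows? : ∀ N → Dec (Arrows N H)
  arrows? N = map′ FiniteArrows⇒Arrows Arrows⇒FiniteArrows (finiteArrows? N)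

  Arrows-mono : ∀ {M N} → M ≤ N → Arrows M H → Arrows N H
  Arrows-mono {M} {N} M≤N arrows (c , c-sym) =
    let φ , inj , canonical = arrows ((λ i j → c (ι i) (ι j)) , λ i j → c-sym (ι i) (ι j))
    in ι ∘ φ , inj ∘ Fin.inject≤-injective M≤N M≤N _ _ , canonical
    where
    ι : Fin M → Fin N
    ι i = inject≤ i M≤N

least : {P : ℕ → Set} → Decidable P → ∀ n → P n → ∃ λ m → m ≤ n × P m × (∀ j → j < m → ¬ P j)
least {P} P? n p = [ (λ { (m , m<n , rest) → m , <⇒≤ m<n , rest }) , (λ none → n , ≤-refl , p , none) ]′ (search n)
  where
  search : ∀ n → (∃ λ m → m < n × P m × (∀ j → j < m → ¬ P j)) ⊎ (∀ j → j < n → ¬ P j)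
  search zero = inj₂ λ _ ()
  search (suc n) with search n
  ... | inj₁ (m , m<n , rest) = inj₁ (m , m<n⇒m<1+n m<n , rest)
  ... | inj₂ none with P? n
  ...   | yes q = inj₁ (n , n<1+n n , q , none)
  ...   | no ¬q = inj₂ λ j j<1+n → [ none j , (λ { refl → ¬q }) ]′ (m≤n⇒m<n∨m≡n (≤-pred j<1+n))

Erdős–Rado-number : ∀ {n} (H : Graph n) {N} → Arrows N H → ∃ λ E → IsER H E × E ≤ N
Erdős–Rado-number H {N} arrows = let E , E≤N , rest = least (arrows? H) N arrows in E , rest , E≤N

IsER-lower : ∀ {n} (H : Graph n) {E M} → IsER H E → ¬ Arrows M H → M < E
IsER-lower H (arrows , _) ¬arrows = ≰⇒> λ E≤M → ¬arrows (Arrows-mono H E≤M arrows)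

-- Lower bounds

∑-cartesianProduct : {A B : Set} (xs : List A) (ys : List B) (f : A × B → ℕ) →
  ∑ (cartesianProduct xs ys) f ≡ ∑[ x ∈ xs ] ∑[ y ∈ ys ] f (x , y)
∑-cartesianProduct [] ys f = refl
∑-cartesianProduct (x ∷ xs) ys f = trans (∑-++ (map (x ,_) ys) (cartesianProduct xs ys) f)
  (cong₂ _+_ (∑-map (x ,_) ys f) (∑-cartesianProduct xs ys f))

length-cartesianProduct : {A B : Set} (xs : List A) (ys : List B) → length (cartesianProduct xs ys) ≡ length xs * length ys
length-cartesianProduct xs ys = begin
  length (cartesianProduct xs ys)     ≡⟨ length-∑ (cartesianProduct xs ys) ⟩
  ∑[ _ ∈ cartesianProduct xs ys ] 1   ≡⟨ ∑-cartesianProduct xs ys (λ _ → 1) ⟩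
  ∑[ _ ∈ xs ] ∑[ _ ∈ ys ] 1           ≡⟨ ∑-cong xs (λ _ → sym (length-∑ ys)) ⟩
  ∑[ _ ∈ xs ] length ys               ≡⟨ ∑-const xs (length ys) ⟩
  length xs * length ys               ∎
  where open ≡-Reasoning

Unique-length≤ : ∀ {n r} {P : Fin n → Set} (P? : Decidable P) (g : Fin n → ℕ) →
  (∀ {u} → P u → g u < r) → (∀ {u w} → P u → P w → g u ≡ g w → u ≡ w) → # P? (allFin n) ≤ r
Unique-length≤ {n} {r} {P} P? g g<r g-inj = Fin.injective⇒≤ {f = h} h-inj
  where
  us = filter P? (allFin n)
  holds : ∀ i → P (lookup us i)
  holds i = proj₂ (∈-filter⁻ P? {xs = allFin n} (∈-lookup {xs = us} i))
  h : Fin (length us) → Fin r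
  h i = fromℕ< (g<r (holds i))
  distinct = AllPairs-lookup (filter⁺ P? (allFin⁺ n))
  h-inj : Injective _≡_ _≡_ h
  h-inj {i} {k} eq with Fin.<-cmp i k | g-inj (holds i) (holds k) (Fin.fromℕ<-injective _ _ (g<r (holds i)) (g<r (holds k)) eq)
  ... | tri< lt _ _ | p = ⊥-elim (distinct i k lt p)
  ... | tri≈ _ q _ | p = q
  ... | tri> _ _ gt | p = ⊥-elim (distinct k i gt (sym p))

degree-∑ : ∀ {n} (H : Graph n) u → degree H u ≡ ∑[ w ∈ allFin n ] 𝟙 (edge? H u w)
degree-∑ {n} H u = trans (sym (length-neighbours H u)) (#-∑ (edge? H u) (allFin n))

module _ {n d : ℕ} (H : Graph n) (regular : Regular H d) (0<d : 0 < d) where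

  -- The vertices without forward edges form an independent set, hence are at most half of all vertices,
  -- and the other vertices have distinct forward colours.
  forward-colours : ∀ {r} (e : Fin n → Fin n → ℕ) (pos : Fin n → Fin n) → Injective _≡_ _≡_ pos →
    (∀ u v → Edge H u v → e u v < r) →
    (∀ u v u' v' → Edge H u v → Edge H u' v' → toℕ (pos u) < toℕ (pos v) → toℕ (pos u') < toℕ (pos v') →
      e u v ≡ e u' v' → u ≡ u') → n ≤ 2 * r
  forward-colours {r} e pos pos-inj e<r distinct = begin
    n                                     ≡⟨ length-allFin n ⟨
    length (allFin n)                     ≡⟨ #-complement forward? (allFin n) ⟨
    # forward? (allFin n) + # (¬? ∘ forward?) (allFin n) ≤⟨ +-mono-≤ forward≤r (≤-trans independent forward≤r) ⟩
    r + r                                 ≡⟨ cong (r +_) (+-identityʳ r) ⟨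
    2 * r                                 ∎
    where
    open ≤-Reasoning
    Forward : Fin n → Set
    Forward u = ∃ λ v → Edge H u v × toℕ (pos u) < toℕ (pos v)
    forward? : Decidable Forward
    forward? u = Fin.any? λ v → edge? H u v ×-dec (toℕ (pos u) <? toℕ (pos v))
    colour : ∀ u → Dec (Forward u) → ℕ
    colour u (yes (v , _)) = e u v
    colour u (no _) = 0
    colour< : ∀ u (D : Dec (Forward u)) → Forward u → colour u D < r
    colour< u (yes (v , p , _)) _ = e<r u v p
    colour< u (no ¬f) f = ⊥-elim (¬f f)
    colour-inj : ∀ u w (D : Dec (Forward u)) (D' : Dec (Forward w)) → Forward u → Forward w → colour u D ≡ colour w D' → u ≡ w
    colour-inj u w (yes (v , p , lt)) (yes (v' , q , lt')) _ _ eq = distinct u v w v' p q lt lt' eq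
    colour-inj u w (yes _) (no ¬f) _ f _ = ⊥-elim (¬f f)
    colour-inj u w (no ¬f) _ f _ _ = ⊥-elim (¬f f)
    forward≤r : # forward? (allFin n) ≤ r
    forward≤r = Unique-length≤ forward? (λ u → colour u (forward? u)) (λ {u} → colour< u (forward? u))
      (λ {u} {w} → colour-inj u w (forward? u) (forward? w))
    -- Double counting: an edge at a vertex without forward edges goes backwards, so its other end
    -- has a forward edge. By regularity the two sets send out `d` edges per vertex.
    pointwise : ∀ u w → 𝟙 (edge? H u w) * 𝟙 (¬? (forward? u)) ≤ 𝟙 (edge? H w u) * 𝟙 (forward? w)
    pointwise u w with edge? H u w
    ... | no _ = z≤n
    ... | yes p = begin
      1 * 𝟙 (¬? (forward? u))                 ≤⟨ *-monoʳ-≤ 1 (𝟙-mono (¬? (forward? u)) (forward? w) back) ⟩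
      1 * 𝟙 (forward? w)                      ≡⟨ cong (_* 𝟙 (forward? w)) (𝟙-yes (edge? H w u) p') ⟨
      𝟙 (edge? H w u) * 𝟙 (forward? w)        ∎
      where
      p' = trans (adj-sym H w u) p
      back : ¬ Forward u → Forward w
      back ¬f with Fin.<-cmp (pos u) (pos w)
      ... | tri< lt _ _ = ⊥-elim (¬f (w , p , lt))
      ... | tri> _ _ gt = u , p' , gt
      ... | tri≈ _ eq _ with pos-inj eq
      ...   | refl with trans (sym p) (irrefl H u)
      ...     | ()
    weigh : ∀ {P : Fin n → Set} (P? : Decidable P) →
      ∑[ u ∈ allFin n ] ∑[ w ∈ allFin n ] (𝟙 (edge? H u w) * 𝟙 (P? u)) ≡ d * # P? (allFin n)
    weigh P? = begin-equality
      ∑[ u ∈ allFin n ] ∑[ w ∈ allFin n ] (𝟙 (edge? H u w) * 𝟙 (P? u))   ≡⟨ ∑-cong (allFin n) (λ u → ∑-cong (allFin n) (λ w → *-comm (𝟙 (edge? H u w)) _)) ⟩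
      ∑[ u ∈ allFin n ] ∑[ w ∈ allFin n ] (𝟙 (P? u) * 𝟙 (edge? H u w))   ≡⟨ ∑-cong (allFin n) (λ u → ∑-*ˡ (𝟙 (P? u)) (allFin n) _) ⟩
      ∑[ u ∈ allFin n ] (𝟙 (P? u) * ∑[ w ∈ allFin n ] 𝟙 (edge? H u w))   ≡⟨ ∑-cong (allFin n) (λ u → trans (cong (𝟙 (P? u) *_) (trans (sym (degree-∑ H u)) (regular u))) (*-comm (𝟙 (P? u)) d)) ⟩
      ∑[ u ∈ allFin n ] (d * 𝟙 (P? u))                                   ≡⟨ ∑-*ˡ d (allFin n) _ ⟩
      d * ∑[ u ∈ allFin n ] 𝟙 (P? u)                                     ≡⟨ cong (d *_) (#-∑ P? (allFin n)) ⟨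
      d * # P? (allFin n)                                                ∎
    independent : # (¬? ∘ forward?) (allFin n) ≤ # forward? (allFin n)
    independent = *-cancelˡ-≤ d {{>-nonZero 0<d}} (begin
      d * # (¬? ∘ forward?) (allFin n)                                                ≡⟨ weigh (¬? ∘ forward?) ⟨
      ∑[ u ∈ allFin n ] ∑[ w ∈ allFin n ] (𝟙 (edge? H u w) * 𝟙 (¬? (forward? u)))     ≤⟨ ∑-mono (allFin n) (λ {u} _ → ∑-mono (allFin n) (λ {w} _ → pointwise u w)) ⟩
      ∑[ u ∈ allFin n ] ∑[ w ∈ allFin n ] (𝟙 (edge? H w u) * 𝟙 (forward? w))          ≡⟨ ∑-swap (allFin n) (allFin n) _ ⟩
      ∑[ w ∈ allFin n ] ∑[ u ∈ allFin n ] (𝟙 (edge? H w u) * 𝟙 (forward? w))          ≡⟨ weigh forward? ⟩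
      d * # forward? (allFin n)                                                       ∎)

  -- A rainbow copy has distinct forward colours for every ordering, in particular for `id`, and a
  -- lexicographic copy for its own. Both would need at least n/2 colours.
  few-colours : ∀ {r N} (c : SymColoring N) → (∀ i j → i ≢ j → proj₁ c i j < r) → 2 * r < n →
    (∀ φ → Injective _≡_ _≡_ φ → ¬ Monochromatic H (proj₁ c) φ) → ¬ Arrows N H
  few-colours {r} c c<r 2r<n no-mono arrows with arrows c
  ... | φ , inj , canonical = by-case canonical
    where
    edge< : ∀ u v → Edge H u v → proj₁ c (φ u) (φ v) < r
    edge< u v p = c<r (φ u) (φ v) λ eq → loop (inj eq) p
      where
      loop : ∀ {u v} → u ≡ v → ¬ Edge H u v
      loop {u} refl p with trans (sym p) (irrefl H u)
      ... | ()
    by-case : ¬ Canonical H (proj₁ c) φ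
    by-case (inj₁ mono) = no-mono φ inj mono
    by-case (inj₂ (inj₁ rainbow)) = <⇒≱ 2r<n (forward-colours _ id id edge< λ u v u' v' p q lt lt' eq →
      [ proj₁ , (λ { (refl , refl) → ⊥-elim (<-asym lt lt') }) ]′ (rainbow u v u' v' p q eq))
    by-case (inj₂ (inj₂ (pos , pos-inj , col , col-inj , lex))) = <⇒≱ 2r<n (forward-colours _ pos pos-inj edge<
      λ u v u' v' p q lt lt' eq → col-inj (trans (sym (lex u v p lt)) (trans eq (lex u' v' q lt'))))

-- Lower bound for non-bipartite graphs: the first differing binary digit

first-difference : ∀ {r} (f g : Fin r → Fin 2) → ℕ
first-difference {zero} f g = 0
first-difference {suc r} f g = if does (f zero Fin.≟ g zero) then suc (first-difference (f ∘ suc) (g ∘ suc)) else 0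

first-difference-sym : ∀ {r} (f g : Fin r → Fin 2) → first-difference f g ≡ first-difference g f
first-difference-sym {zero} f g = refl
first-difference-sym {suc r} f g with f zero Fin.≟ g zero | g zero Fin.≟ f zero
... | yes _ | yes _ = cong suc (first-difference-sym (f ∘ suc) (g ∘ suc))
... | yes p | no ¬q = ⊥-elim (¬q (sym p))
... | no ¬p | yes q = ⊥-elim (¬p (sym q))
... | no _ | no _ = refl

first-difference-spec : ∀ {r} (f g : Fin r → Fin 2) → (∀ i → f i ≡ g i) ⊎ (∃ λ i → toℕ i ≡ first-difference f g × f i ≢ g i)
first-difference-spec {zero} f g = inj₁ λ ()
first-difference-spec {suc r} f g with f zero Fin.≟ g zero
... | no ¬p = inj₂ (zero , refl , ¬p)
... | yes p with first-difference-spec (f ∘ suc) (g ∘ suc)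
...   | inj₁ eq = inj₁ λ { zero → p ; (suc i) → eq i }
...   | inj₂ (i , toℕ≡ , distinct) = inj₂ (suc i , cong suc toℕ≡ , distinct)

funToFin-cong : ∀ {m n} {f g : Fin m → Fin n} → (∀ i → f i ≡ g i) → funToFin f ≡ funToFin g
funToFin-cong {zero} eq = refl
funToFin-cong {suc m} eq = cong₂ combine (eq zero) (funToFin-cong (eq ∘ suc))

finToFun-injective : ∀ {m n} {x y : Fin (n ^ m)} → (∀ i → finToFun {n} {m} x i ≡ finToFun {n} {m} y i) → x ≡ y
finToFun-injective {m} {n} {x} {y} eq =
  trans (sym (Fin.funToFin-finToFin {m} {n} x)) (trans (funToFin-cong eq) (Fin.funToFin-finToFin {m} {n} y))

module _ {n d : ℕ} (H : Graph n) (regular : Regular H d) (0<d : 0 < d) where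

  -- The ends of an edge of colour `κ` differ in digit `κ`, so that digit would be a proper
  -- 2-colouring of a monochromatic copy.
  binary-lower-bound : ∀ r → 2 * r < n → ¬ Colorable H 2 → ¬ Arrows (2 ^ r) H
  binary-lower-bound r 2r<n not-bipartite = few-colours H regular 0<d (c , c-sym) c<r 2r<n no-mono
    where
    bits : Fin (2 ^ r) → Fin r → Fin 2
    bits = finToFun {2} {r}
    c : Fin (2 ^ r) → Fin (2 ^ r) → ℕ
    c i j = first-difference (bits i) (bits j)
    c-sym : ∀ i j → c i j ≡ c j i
    c-sym i j = first-difference-sym (bits i) (bits j)
    differ : ∀ {i j} → i ≢ j → ∃ λ k → toℕ k ≡ c i j × bits i k ≢ bits j k
    differ {i} {j} i≢j with first-difference-spec (bits i) (bits j)
    ... | inj₁ eq = ⊥-elim (i≢j (finToFun-injective eq))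
    ... | inj₂ found = found
    c<r : ∀ i j → i ≢ j → c i j < r
    c<r i j i≢j = let k , eq , _ = differ i≢j in subst (_< r) eq (Fin.toℕ<n k)
    edge-≢ : ∀ {φ : Fin n → Fin (2 ^ r)} → Injective _≡_ _≡_ φ → ∀ {u w} → Edge H u w → φ u ≢ φ w
    edge-≢ inj {u} p eq with inj eq
    ... | refl with trans (sym p) (irrefl H u)
    ...   | ()
    no-mono : ∀ φ → Injective _≡_ _≡_ φ → ¬ Monochromatic H c φ
    no-mono φ inj (κ , mono) with κ <? r
    ... | yes κ<r = not-bipartite ((λ u → bits (φ u) (fromℕ< κ<r)) , λ u w p →
      let k , eq , distinct = differ (edge-≢ inj p)
      in subst (λ k → bits (φ u) k ≢ bits (φ w) k) (Fin.toℕ-injective (trans eq (trans (mono u w p) (sym (Fin.toℕ-fromℕ< κ<r))))) distinct)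
    -- No edge has a colour outside the range, so `H` would be edgeless and a constant colouring
    -- proper.
    ... | no κ≮r = not-bipartite ((λ _ → zero) , λ u w p _ → κ≮r (subst (_< r) (mono u w p) (c<r (φ u) (φ w) (edge-≢ inj p))))

-- Lower bound for bipartite graphs: random colourings

prescribed-coordinates : ∀ {r M} (κ : Fin r) (L : List (Fin M)) → Unique L →
  r ^ length L * # (λ v → All.all? (λ l → lookupᵛ v l Fin.≟ κ) L) (vecs M (allFin r)) ≤ length (vecs M (allFin r))
prescribed-coordinates {r} {M} κ [] _ = ≤-trans (≤-reflexive (*-identityˡ _)) (length-filter (λ v → All.all? (λ l → lookupᵛ v l Fin.≟ κ) []) (vecs M (allFin r)))
prescribed-coordinates {r} {M} κ (l ∷ L) (l∉ ∷ uniq) = begin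
  r * r ^ length L * # (agree? (l ∷ L)) vs     ≡⟨ cong (_* # (agree? (l ∷ L)) vs) (*-comm r (r ^ length L)) ⟩
  r ^ length L * r * # (agree? (l ∷ L)) vs     ≡⟨ *-assoc (r ^ length L) r _ ⟩
  r ^ length L * (r * # (agree? (l ∷ L)) vs)   ≤⟨ *-monoʳ-≤ (r ^ length L) one-more ⟩
  r ^ length L * # (agree? L) vs               ≤⟨ prescribed-coordinates κ L uniq ⟩
  length vs                                    ∎
  where
  open ≤-Reasoning
  vs = vecs M (allFin r)
  agree? : ∀ L → Decidable (λ (v : Vec (Fin r) M) → All (λ l → lookupᵛ v l ≡ κ) L)
  agree? L v = All.all? (λ l → lookupᵛ v l Fin.≟ κ) L
  others : ∀ {L} → All (l ≢_) L → ∀ v x → All (λ k → lookupᵛ (v [ l ]≔ x) k ≡ κ) L → All (λ k → lookupᵛ v k ≡ κ) L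
  others [] v x [] = []
  others (l≢k ∷ l∉) v x (p ∷ ps) = trans (sym (lookup∘update′ (l≢k ∘ sym) v x)) p ∷ others l∉ v x ps
  -- With the other coordinates fixed, at most one value at `l` is admissible, and none if another
  -- prescribed coordinate is wrong. Each prescribed coordinate thus costs a factor `r`.
  fibre : ∀ v → # (λ x → agree? (l ∷ L) (v [ l ]≔ x)) (allFin r) ≤ 𝟙 (agree? L v)
  fibre v with agree? L v
  ... | yes _ = ≤-trans
    (#-mono (λ x → agree? (l ∷ L) (v [ l ]≔ x)) (κ Fin.≟_) (allFin r) (λ {x} _ → λ { (p ∷ _) → trans (sym p) (lookup∘update l v x) }))
    (#-≡-Unique Fin._≟_ κ (allFin⁺ r))
  ... | no ¬a = ≤-trans
    (#-mono (λ x → agree? (l ∷ L) (v [ l ]≔ x)) (λ _ → no id) (allFin r) (λ {x} _ → λ { (_ ∷ ps) → ¬a (others l∉ v x ps) }))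
    (≤-reflexive (trans (#-∑ (λ _ → no id) (allFin r)) (trans (∑-const (allFin r) 0) (*-zeroʳ (length (allFin r))))))
  one-more : r * # (agree? (l ∷ L)) vs ≤ # (agree? L) vs
  one-more = begin
    r * # (agree? (l ∷ L)) vs                                             ≡⟨ cong₂ _*_ (sym (length-allFin r)) (#-∑ (agree? (l ∷ L)) vs) ⟩
    length (allFin r) * ∑[ v ∈ vs ] 𝟙 (agree? (l ∷ L) v)                  ≡⟨ ∑-vecs-update l (allFin r) _ ⟩
    ∑[ v ∈ vs ] ∑[ x ∈ allFin r ] 𝟙 (agree? (l ∷ L) (v [ l ]≔ x))         ≡⟨ ∑-cong vs (λ v → #-∑ (λ x → agree? (l ∷ L) (v [ l ]≔ x)) (allFin r)) ⟨
    ∑[ v ∈ vs ] # (λ x → agree? (l ∷ L) (v [ l ]≔ x)) (allFin r)          ≤⟨ ∑-mono vs (λ {v} _ → fibre v) ⟩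
    ∑[ v ∈ vs ] 𝟙 (agree? L v)                                            ≡⟨ #-∑ (agree? L) vs ⟨
    # (agree? L) vs                                                       ∎

module _ {N r : ℕ} (χ : Fin (N * N) → Fin r) where

  -- The random table has independent entries for all ordered pairs. Reading it only at pairs in
  -- increasing order, and on the diagonal, makes the colouring symmetric.
  pairColour : Fin N → Fin N → ℕ
  pairColour i j with Fin.<-cmp i j
  ... | tri< _ _ _ = toℕ (χ (combine i j))
  ... | tri≈ _ _ _ = toℕ (χ (combine i j))
  ... | tri> _ _ _ = toℕ (χ (combine j i))

  pairColour-sym : ∀ i j → pairColour i j ≡ pairColour j i
  pairColour-sym i j with Fin.<-cmp i j | Fin.<-cmp j i
  ... | tri< i<j _ _ | tri> _ _ _ = refl
  ... | tri≈ _ refl _ | tri≈ _ _ _ = refl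
  ... | tri> _ _ _ | tri< _ _ _ = refl
  ... | tri< i<j _ _ | tri< j<i _ _ = ⊥-elim (<-asym i<j j<i)
  ... | tri< _ i≢j _ | tri≈ _ j≡i _ = ⊥-elim (i≢j (sym j≡i))
  ... | tri≈ _ i≡j _ | tri< _ j≢i _ = ⊥-elim (j≢i (sym i≡j))
  ... | tri≈ _ i≡j _ | tri> _ j≢i _ = ⊥-elim (j≢i (sym i≡j))
  ... | tri> _ i≢j _ | tri≈ _ j≡i _ = ⊥-elim (i≢j (sym j≡i))
  ... | tri> _ _ j<i | tri> _ _ i<j = ⊥-elim (<-asym i<j j<i)

  pairColour< : ∀ i j → pairColour i j < r
  pairColour< i j with Fin.<-cmp i j
  ... | tri< _ _ _ = Fin.toℕ<n _
  ... | tri≈ _ _ _ = Fin.toℕ<n _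
  ... | tri> _ _ _ = Fin.toℕ<n _

  pairColour-ordered : ∀ {i j} → toℕ i < toℕ j → pairColour i j ≡ toℕ (χ (combine i j))
  pairColour-ordered {i} {j} i<j with Fin.<-cmp i j
  ... | tri< _ _ _ = refl
  ... | tri≈ _ _ _ = refl
  ... | tri> ¬i<j _ _ = ⊥-elim (¬i<j i<j)

module _ {n d : ℕ} (H : Graph n) (regular : Regular H d) where

  -- Every edge appears exactly once, oriented according to its image.
  ordered? : ∀ {N} (φ : Fin n → Fin N) → Decidable (λ ((u , w) : Fin n × Fin n) → Edge H u w × toℕ (φ u) < toℕ (φ w))
  ordered? φ (u , w) = edge? H u w ×-dec (toℕ (φ u) <? toℕ (φ w))

  orderedEdges : ∀ {N} → (Fin n → Fin N) → List (Fin n × Fin n)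
  orderedEdges φ = filter (ordered? φ) (cartesianProduct (allFin n) (allFin n))

  coordinates : ∀ {N} → (Fin n → Fin N) → List (Fin (N * N))
  coordinates φ = map (λ (u , w) → combine (φ u) (φ w)) (orderedEdges φ)

  coordinates-Unique : ∀ {N} (φ : Fin n → Fin N) → Injective _≡_ _≡_ φ → Unique (coordinates φ)
  coordinates-Unique φ inj = map⁺
    (λ { {u , w} {u' , w'} eq → let p , q = Fin.combine-injective (φ u) (φ w) (φ u') (φ w') eq in cong₂ _,_ (inj p) (inj q) })
    (filter⁺ (ordered? φ) (cartesianProduct⁺ (allFin⁺ n) (allFin⁺ n)))

  -- Handshake lemma: the degrees sum to `n * d`, and each edge is counted from both ends but
  -- oriented in one way only.
  coordinates-length : ∀ {N} (φ : Fin n → Fin N) → Injective _≡_ _≡_ φ → n * d ≤ 2 * length (coordinates φ)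
  coordinates-length φ inj = begin
    n * d                                                             ≡⟨ cong (_* d) (length-allFin n) ⟨
    length us * d                                                     ≡⟨ ∑-const us d ⟨
    ∑[ u ∈ us ] d                                                     ≡⟨ ∑-cong us (λ u → trans (sym (regular u)) (degree-∑ H u)) ⟩
    ∑[ u ∈ us ] ∑[ w ∈ us ] 𝟙 (edge? H u w)                           ≤⟨ ∑-mono us (λ {u} _ → ∑-mono us (λ {w} _ → pointwise u w)) ⟩
    ∑[ u ∈ us ] ∑[ w ∈ us ] (𝟙 (ordered? φ (u , w)) + 𝟙 (ordered? φ (w , u))) ≡⟨ ∑-cong us (λ u → ∑-+ us _ _) ⟩
    ∑[ u ∈ us ] (∑[ w ∈ us ] 𝟙 (ordered? φ (u , w)) + ∑[ w ∈ us ] 𝟙 (ordered? φ (w , u))) ≡⟨ ∑-+ us _ _ ⟩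
    total + ∑[ u ∈ us ] ∑[ w ∈ us ] 𝟙 (ordered? φ (w , u))            ≡⟨ cong (total +_) (∑-swap us us (λ u w → 𝟙 (ordered? φ (w , u)))) ⟩
    total + total                                                     ≡⟨ cong (total +_) (+-identityʳ total) ⟨
    2 * total                                                         ≡⟨ cong (2 *_) (trans (sym (∑-cartesianProduct us us (𝟙 ∘ ordered? φ))) (sym (#-∑ (ordered? φ) (cartesianProduct us us)))) ⟩
    2 * length (orderedEdges φ)                                       ≡⟨ cong (2 *_) (length-map _ (orderedEdges φ)) ⟨
    2 * length (coordinates φ)                                        ∎
    where
    open ≤-Reasoning
    us = allFin n
    total = ∑[ u ∈ us ] ∑[ w ∈ us ] 𝟙 (ordered? φ (u , w))
    pointwise : ∀ u w → 𝟙 (edge? H u w) ≤ 𝟙 (ordered? φ (u , w)) + 𝟙 (ordered? φ (w , u))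
    pointwise u w with Fin.<-cmp (φ u) (φ w)
    ... | tri< lt _ _ = ≤-trans (𝟙-mono (edge? H u w) (ordered? φ (u , w)) (λ p → p , lt)) (m≤m+n _ _)
    ... | tri> _ _ gt = ≤-trans (𝟙-mono (edge? H u w) (ordered? φ (w , u)) (λ p → trans (adj-sym H w u) p , gt)) (m≤n+m _ _)
    ... | tri≈ _ eq _ with inj eq
    ...   | refl = ≤-trans (≤-reflexive (𝟙-no (edge? H u u) λ p → true≢false (trans (sym p) (irrefl H u)))) z≤n
      where
      true≢false : true ≢ false
      true≢false ()

  -- Union bound over the `N ^ n` placements and the `r` colours. An injective placement uses at
  -- least `K` distinct table entries, so it is monochromatic in a given colour with probability at
  -- most `r ^ K` inverted.
  random-lower-bound : ∀ {N} r K → N ^ n * r < r ^ K → 2 * K ≤ n * d → 0 < r → 2 * r < n → 0 < d → ¬ Arrows N H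
  random-lower-bound {N} r K few 2K≤nd 0<r 2r<n 0<d =
    few-colours H regular 0<d (pairColour (lookupᵛ χ) , pairColour-sym (lookupᵛ χ)) (λ i j _ → pairColour< (lookupᵛ χ) i j) 2r<n no-mono
    where
    open ≤-Reasoning
    colourings = vecs (N * N) (allFin r)
    events = cartesianProduct (vecs n (allFin N)) (allFin r)
    Bad : Vec (Fin N) n × Fin r → Vec (Fin r) (N * N) → Set
    Bad (v , κ) χ = Injective _≡_ _≡_ (lookupᵛ v) × All (λ l → lookupᵛ χ l ≡ κ) (coordinates (lookupᵛ v))
    agree? : ∀ κ L → Decidable (λ (χ : Vec (Fin r) (N * N)) → All (λ l → lookupᵛ χ l ≡ κ) L)
    agree? κ L χ = All.all? (λ l → lookupᵛ χ l Fin.≟ κ) L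
    bad? : ∀ e χ → Dec (Bad e χ)
    bad? (v , κ) χ = injective? (lookupᵛ v) ×-dec agree? κ (coordinates (lookupᵛ v)) χ
    rare : ∀ e → r ^ K * # (bad? e) colourings ≤ length colourings
    rare (v , κ) = by-injectivity (injective? φ)
      where
      φ = lookupᵛ v
      by-injectivity : Dec (Injective _≡_ _≡_ φ) → r ^ K * # (bad? (v , κ)) colourings ≤ length colourings
      by-injectivity (yes inj) = begin
        r ^ K * # (bad? (v , κ)) colourings                               ≤⟨ *-mono-≤
          (^-monoʳ-≤ r {{>-nonZero 0<r}} {K} {length (coordinates φ)} (*-cancelˡ-≤ {K} {length (coordinates φ)} 2 (≤-trans 2K≤nd (coordinates-length φ inj))))
          (#-mono (bad? (v , κ)) (agree? κ (coordinates φ)) colourings (λ _ → proj₂)) ⟩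
        r ^ length (coordinates φ) * # (agree? κ (coordinates φ)) colourings ≤⟨ prescribed-coordinates κ (coordinates φ) (coordinates-Unique φ inj) ⟩
        length colourings                                                 ∎
      by-injectivity (no ¬inj) = begin
        r ^ K * # (bad? (v , κ)) colourings          ≤⟨ *-monoʳ-≤ (r ^ K) (#-mono (bad? (v , κ)) (λ _ → no id) colourings (λ _ b → ¬inj (proj₁ b))) ⟩
        r ^ K * # (λ _ → no id) colourings           ≡⟨ cong (r ^ K *_) (trans (#-∑ (λ _ → no id) colourings) (trans (∑-const colourings 0) (*-zeroʳ (length colourings)))) ⟩
        r ^ K * 0                                    ≡⟨ *-zeroʳ (r ^ K) ⟩
        0                                            ≤⟨ z≤n ⟩
        length colourings                            ∎
    good : ∃ λ χ → χ ∈ colourings × (∀ {e} → e ∈ events → ¬ Bad e χ)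
    good = union-bound bad? colourings events (r ^ K) (λ {e} _ → rare e)
      (subst (_< r ^ K) (sym (trans (length-cartesianProduct (vecs n (allFin N)) (allFin r))
        (cong₂ _*_ (trans (length-vecs n (allFin N)) (cong (_^ n) (length-allFin N))) (length-allFin r)))) few)
      (subst (0 <_) (sym (trans (length-vecs (N * N) (allFin r)) (cong (_^ (N * N)) (length-allFin r)))) (m^n>0 r {{>-nonZero 0<r}} (N * N)))
    χ = proj₁ good
    c = pairColour (lookupᵛ χ)
    no-mono : ∀ φ → Injective _≡_ _≡_ φ → ¬ Monochromatic H c φ
    no-mono φ inj (κ , mono) = proj₂ (proj₂ good) {v , κ'} (∈-cartesianProduct⁺ (∈-vecs⁺ v (λ _ → ∈-allFin _)) (∈-allFin κ'))
      ((λ {u} {w} eq → inj (trans (sym (φ≗ u)) (trans eq (φ≗ w)))) , All.tabulate agree)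
      where
      v = tabulateᵛ φ
      φ≗ : ∀ i → lookupᵛ v i ≡ φ i
      φ≗ = lookup∘tabulate φ
      some-edge : ∃ λ u → ∃ λ w → Edge H u w
      some-edge = u , edge-at (neighbours H u) refl
        where
        u : Fin n
        u = fromℕ< (≤-<-trans z≤n 2r<n)
        edge-at : ∀ ws → neighbours H u ≡ ws → ∃ λ w → Edge H u w
        edge-at [] eq = ⊥-elim (<⇒≢ 0<d (trans (cong length (sym eq)) (trans (length-neighbours H u) (regular u))))
        edge-at (w ∷ _) eq = w , proj₂ (∈-filter⁻ (λ w → adj H u w Bool.≟ true) {xs = allFin n} (subst (w ∈_) (sym eq) (here refl)))
      -- The colour of a monochromatic copy is an arbitrary natural number; an actual edge shows
      -- that it is one of the `r` colours.
      κ<r : κ < r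
      κ<r = let u , w , p = some-edge in subst (_< r) (mono u w p) (pairColour< (lookupᵛ χ) (φ u) (φ w))
      κ' = fromℕ< κ<r
      agree : ∀ {l} → l ∈ coordinates (lookupᵛ v) → lookupᵛ χ l ≡ κ'
      agree l∈ with ∈-map⁻ (λ (u , w) → combine (lookupᵛ v u) (lookupᵛ v w)) l∈
      ... | (u , w) , uw∈ , refl with ∈-filter⁻ (ordered? (lookupᵛ v)) {xs = cartesianProduct (allFin n) (allFin n)} uw∈
      ...   | _ , p , lt = Fin.toℕ-injective (trans (sym (pairColour-ordered (lookupᵛ χ) lt))
              (trans (cong₂ c (φ≗ u) (φ≗ w)) (trans (mono u w p) (sym (Fin.toℕ-fromℕ< κ<r)))))

-- Numerical estimates

Colorable-size : ∀ {n} (H : Graph n) → Colorable H n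
Colorable-size H = id , λ { u v e refl → true≢false (trans (sym e) (irrefl H u)) }
  where
  true≢false : true ≢ false
  true≢false ()

chromatic≤size : ∀ {n k} (H : Graph n) → IsChromatic H k → k ≤ n
chromatic≤size H (_ , minimal) = ≮⇒≥ λ n<k → minimal _ n<k (Colorable-size H)

degree≤size : ∀ {n} (H : Graph n) u → degree H u ≤ n
degree≤size {n} H u = begin
  degree H u                ≡⟨ length-neighbours H u ⟨
  length (neighbours H u)   ≤⟨ length-filter (λ w → adj H u w Bool.≟ true) (allFin n) ⟩
  length (allFin n)         ≡⟨ length-allFin n ⟩
  n                         ∎
  where open ≤-Reasoning

edge⇒degree>0 : ∀ {n} (H : Graph n) {u w} → Edge H u w → 0 < degree H u
edge⇒degree>0 H {u} {w} e = ≤-trans (∈-length (∈-filter⁺ (λ w → adj H u w Bool.≟ true) (∈-allFin w) e)) (≤-reflexive (length-neighbours H u))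

chromatic⇒degree>0 : ∀ {n d k} (H : Graph n) → Regular H d → IsChromatic H k → 2 ≤ k → 0 < d
chromatic⇒degree>0 H regular (_ , minimal) 2≤k = n≢0⇒n>0 λ { refl →
  minimal 1 2≤k ((λ _ → zero) , λ u v e _ → <⇒≢ (edge⇒degree>0 H e) (sym (regular u))) }

size≤ER : ∀ {n} (H : Graph n) {E} → IsER H E → n ≤ E
size≤ER H (arrows , _) = let _ , inj , _ = arrows ((λ _ _ → 0) , λ _ _ → refl) in Fin.injective⇒≤ inj

-- The witness is (m - 1)/2 rounded down: few enough colours for `few-colours`, yet about half of
-- `m`.
halve : ∀ m → 0 < m → ∃ λ r → 2 * r < m × m ≤ 2 * suc r
halve 1 _ = 0 , s≤s z≤n , s≤s z≤n
halve 2 _ = 0 , s≤s z≤n , ≤-refl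
halve (suc (suc (suc m))) _ =
  let r , lt , le = halve (suc m) (s≤s z≤n)
  in suc r , subst (_< suc (suc (suc m))) (sym (*-suc 2 r)) (s≤s (s≤s lt)) , subst (suc (suc (suc m)) ≤_) (sym (*-suc 2 (suc r))) (s≤s (s≤s le))

2*[1+r]≤3*r : ∀ {r} → 2 ≤ r → 2 * suc r ≤ 3 * r
2*[1+r]≤3*r {r} 2≤r = ≤-trans (≤-reflexive (*-suc 2 r)) (+-monoˡ-≤ (2 * r) 2≤r)

module _ {n : ℕ} (2≤n : 2 ≤ n) where

  private instance
    n≢0 : NonZero n
    n≢0 = >-nonZero (≤-trans (s≤s z≤n) 2≤n)

  open ≤-Reasoning

  double≤ : ∀ {a} m → a ≤ n ^ m → 2 * a ≤ n ^ suc m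
  double≤ m a≤ = *-mono-≤ 2≤n a≤

  n⁴<n⁵ : n ^ 4 < n ^ 5
  n⁴<n⁵ = ^-monoʳ-< n 2≤n (n<1+n 4)

  2n≤2n⁵ : n + n ≤ 2 * n ^ 5
  2n≤2n⁵ = begin
    n + n       ≡⟨ cong (n +_) (+-identityʳ n) ⟨
    2 * n       ≤⟨ *-monoʳ-≤ 2 (m≤m*n n (n ^ 4) {{>-nonZero (m^n>0 n 4)}}) ⟩
    2 * n ^ 5   ∎

  [2n⁵]^≤ : ∀ m → (2 * n ^ 5) ^ m ≤ n ^ (6 * m)
  [2n⁵]^≤ m = ≤-trans (^-monoˡ-≤ m (double≤ 5 ≤-refl)) (≤-reflexive (^-*-assoc n 6 m))

  1+n²≤n³ : suc (n * n) ≤ n ^ 3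
  1+n²≤n³ = begin
    1 + n * n            ≤⟨ +-monoˡ-≤ (n * n) (*-mono-≤ {1} {n} {1} {n} (≤-trans (s≤s z≤n) 2≤n) (≤-trans (s≤s z≤n) 2≤n)) ⟩
    n * n + n * n        ≡⟨ cong (n * n +_) (+-identityʳ (n * n)) ⟨
    2 * (n * n)          ≤⟨ double≤ 2 (≤-reflexive (cong (n *_) (sym (*-identityʳ n)))) ⟩
    n ^ 3                ∎

  module _ {d : ℕ} (0<d : 0 < d) where

    c+6d≤[c+6]d : ∀ c → c + 6 * d ≤ (c + 6) * d
    c+6d≤[c+6]d c = ≤-trans (+-monoˡ-≤ (6 * d) (m≤m*n c d {{>-nonZero 0<d}})) (≤-reflexive (sym (*-distribʳ-+ d c 6)))

    -- With `q = n ^ 5`, the base `2 * q` is at most `n ^ 6`. The exponents are `6 * (2 + d)` for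
    -- the power, 3 for the last factor, 1 for the factor 2 and 1 for strictness, in total
    -- `17 + 6 * d`.
    bipartite-size : 2 * ((2 * n ^ 5) ^ (2 + d) * suc (n * n)) < n ^ (23 * d)
    bipartite-size = begin-strict
      2 * ((2 * n ^ 5) ^ (2 + d) * suc (n * n))   ≤⟨ double≤ {(2 * n ^ 5) ^ (2 + d) * suc (n * n)} (6 * (2 + d) + 3) (≤-trans (*-mono-≤ ([2n⁵]^≤ (2 + d)) 1+n²≤n³) (≤-reflexive (sym (^-distribˡ-+-* n (6 * (2 + d)) 3)))) ⟩
      n ^ suc (6 * (2 + d) + 3)                   <⟨ ^-monoʳ-< n 2≤n (n<1+n (suc (6 * (2 + d) + 3))) ⟩
      n ^ suc (suc (6 * (2 + d) + 3))             ≡⟨ cong (λ z → n ^ suc (suc (z + 3))) (*-distribˡ-+ 6 2 d) ⟩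
      n ^ (2 + (12 + 6 * d + 3))                  ≡⟨ cong (λ z → n ^ (2 + z)) (+-comm (12 + 6 * d) 3) ⟩
      n ^ (17 + 6 * d)                            ≤⟨ ^-monoʳ-≤ n (c+6d≤[c+6]d 17) ⟩
      n ^ (23 * d)                                ∎

    step-size : 2 * n * ((2 * n ^ 5) ^ (2 + d) * 2) ≤ n ^ (21 * d)
    step-size = begin
      2 * n * ((2 * n ^ 5) ^ (2 + d) * 2)     ≤⟨ *-mono-≤ (double≤ 1 (≤-reflexive (sym (*-identityʳ n))))
                                                   (≤-trans (≤-reflexive (*-comm ((2 * n ^ 5) ^ (2 + d)) 2)) (double≤ {(2 * n ^ 5) ^ (2 + d)} (6 * (2 + d)) ([2n⁵]^≤ (2 + d)))) ⟩
      n ^ 2 * n ^ suc (6 * (2 + d))           ≡⟨ ^-distribˡ-+-* n 2 (suc (6 * (2 + d))) ⟨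
      n ^ (3 + 6 * (2 + d))                   ≡⟨ cong (λ z → n ^ (3 + z)) (*-distribˡ-+ 6 2 d) ⟩
      n ^ (15 + 6 * d)                        ≤⟨ ^-monoʳ-≤ n (c+6d≤[c+6]d 15) ⟩
      n ^ (21 * d)                            ∎

    general-size : ∀ k → 0 < k → (2 * n * ((2 * n ^ 5) ^ (2 + d) * 2)) ^ (k * n) * n ≤ n ^ (23 * d * k * n)
    general-size k 0<k = begin
      (2 * n * ((2 * n ^ 5) ^ (2 + d) * 2)) ^ (k * n) * n   ≤⟨ *-monoˡ-≤ n (^-monoˡ-≤ (k * n) step-size) ⟩
      (n ^ (21 * d)) ^ (k * n) * n                          ≡⟨ cong (_* n) (^-*-assoc n (21 * d) (k * n)) ⟩
      n ^ (21 * d * (k * n)) * n                            ≡⟨ *-comm (n ^ (21 * d * (k * n))) n ⟩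
      n ^ (1 + 21 * d * (k * n))                            ≤⟨ ^-monoʳ-≤ n exponent ⟩
      n ^ (23 * d * k * n)                                  ∎
      where
      -- The remaining factor `n` is absorbed by raising 21 to 23.
      exponent : 1 + 21 * d * (k * n) ≤ 23 * d * k * n
      exponent = begin
        1 + 21 * d * (k * n)              ≤⟨ +-monoˡ-≤ (21 * d * (k * n)) (*-mono-≤ {1} {2 * d} {1} {k * n} (≤-trans 0<d (m≤m+n d (d + 0))) (*-mono-≤ {1} {k} {1} {n} 0<k (≤-trans (s≤s z≤n) 2≤n))) ⟩
        2 * d * (k * n) + 21 * d * (k * n) ≡⟨ *-distribʳ-+ (k * n) (2 * d) (21 * d) ⟨
        (2 * d + 21 * d) * (k * n)        ≡⟨ cong (_* (k * n)) (*-distribʳ-+ d 2 21) ⟨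
        23 * d * (k * n)                  ≡⟨ *-assoc (23 * d) k n ⟨
        23 * d * k * n                    ∎

-- The four bounds and the constants

module _ {n d : ℕ} (H : Graph n) (regular : Regular H d) where

  open ≤-Reasoning

  bipartite-upper : IsChromatic H 2 → ∃ λ E → IsER H E × E ≤ n ^ (23 * d)
  bipartite-upper chromatic = Erdős–Rado-number H λ (c , c-sym) →
    Upper.bipartite-copy H regular c c-sym (proj₁ chromatic) (≤-trans (s≤s z≤n) 2≤n) (n ^ 5)
      (n⁴<n⁵ 2≤n) (2n≤2n⁵ 2≤n) (bipartite-size 2≤n (chromatic⇒degree>0 H regular chromatic ≤-refl))
    where 2≤n = chromatic≤size H chromatic

  general-upper : ∀ k → IsChromatic H k → 3 ≤ k → ∃ λ E → IsER H E × E ≤ n ^ (23 * d * k * n)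
  general-upper (suc j) chromatic 3≤k = Erdős–Rado-number H λ (c , c-sym) →
    General.copy H regular c c-sym (proj₁ (proj₁ chromatic)) (proj₂ (proj₁ chromatic)) (≤-trans (s≤s z≤n) 2≤n) (n ^ 5)
      (n⁴<n⁵ 2≤n) (2n≤2n⁵ 2≤n) (general-size 2≤n (chromatic⇒degree>0 H regular chromatic (<⇒≤ 3≤k)) (suc j) (s≤s z≤n))
    where 2≤n = ≤-trans (<⇒≤ 3≤k) (chromatic≤size H chromatic)

  -- For bounded `d` the trivial bound `n ≤ E` suffices. Otherwise take `r` and `t` just below n/2
  -- and d/2; then `n ≤ r ^ 2` and `d ≤ 3 * t`, so `n ^ d` is at most the sixth power of `r ^ t`.
  bipartite-lower : IsChromatic H 2 → ∀ {E} → IsER H E → n ^ d ≤ E ^ 12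
  bipartite-lower chromatic {E} er = by-degree (d ≤? 12)
    where
    2≤n = chromatic≤size H chromatic
    0<n = ≤-trans (s≤s z≤n) 2≤n
    n≤E = size≤ER H er
    E≢0 = >-nonZero (≤-trans 0<n n≤E)
    by-degree : Dec (d ≤ 12) → n ^ d ≤ E ^ 12
    by-degree (yes d≤12) = ≤-trans (^-monoˡ-≤ d n≤E) (^-monoʳ-≤ E {{E≢0}} d≤12)
    by-degree (no d≰12) = begin
      n ^ d                       ≤⟨ ^-monoʳ-≤ n {{>-nonZero 0<n}} (≤-trans d≤2+2t (2*[1+r]≤3*r (large t d≤2+2t 12<d))) ⟩
      n ^ (3 * t)                 ≤⟨ ^-monoˡ-≤ (3 * t) (≤-trans n≤2+2r (≤-trans (2*[1+r]≤3*r 2≤r) (*-monoˡ-≤ r (large′ r n≤2+2r 12<n)))) ⟩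
      (r * r) ^ (3 * t)           ≡⟨ cong (λ z → (r * z) ^ (3 * t)) (*-identityʳ r) ⟨
      (r ^ 2) ^ (3 * t)           ≡⟨ ^-*-assoc r 2 (3 * t) ⟩
      r ^ (2 * (3 * t))           ≡⟨ cong (r ^_) (trans (sym (*-assoc 2 3 t)) (*-comm 6 t)) ⟩
      r ^ (t * 6)                 ≡⟨ ^-*-assoc r t 6 ⟨
      (r ^ t) ^ 6                 ≤⟨ ^-monoˡ-≤ 6 (<⇒≤ (IsER-lower H er not-arrows)) ⟩
      E ^ 6                       ≤⟨ ^-monoʳ-≤ E {{E≢0}} (m≤m+n 6 6) ⟩
      E ^ 12                      ∎
      where
      12<d = ≰⇒> d≰12
      12<n = <-≤-trans 12<d (subst (_≤ n) (regular (fromℕ< 0<n)) (degree≤size H (fromℕ< 0<n)))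
      half-n = halve n 0<n
      half-d = halve d (≤-trans (s≤s z≤n) 12<d)
      r = proj₁ half-n
      t = proj₁ half-d
      2r<n = proj₁ (proj₂ half-n)
      n≤2+2r = proj₂ (proj₂ half-n)
      2t<d = proj₁ (proj₂ half-d)
      d≤2+2t = proj₂ (proj₂ half-d)
      large′ : ∀ r {m} → m ≤ 2 * suc r → 12 < m → 3 ≤ r
      large′ r m≤ 12<m = ≤-trans (m≤m+n 3 3) (≤-pred (*-cancelˡ-< 2 6 (suc r) (<-≤-trans 12<m m≤)))
      large : ∀ r {m} → m ≤ 2 * suc r → 12 < m → 2 ≤ r
      large r m≤ 12<m = <⇒≤ (large′ r m≤ 12<m)
      2≤r = large r n≤2+2r 12<n
      not-arrows : ¬ Arrows (r ^ t) H
      -- The number `2 + t * n` just beats the union bound, whose size is `r ^ (1 + t * n)`. It is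
      -- at most half of `n * d` because `2 * t < d` leaves a spare `n`, which exceeds 4.
      not-arrows = random-lower-bound H regular r (2 + t * n)
        (begin-strict
          (r ^ t) ^ n * r      ≡⟨ cong (_* r) (^-*-assoc r t n) ⟩
          r ^ (t * n) * r      ≡⟨ *-comm (r ^ (t * n)) r ⟩
          r ^ (1 + t * n)      <⟨ ^-monoʳ-< r 2≤r (n<1+n (1 + t * n)) ⟩
          r ^ (2 + t * n)      ∎)
        (begin
          2 * (2 + t * n)      ≡⟨ *-distribˡ-+ 2 2 (t * n) ⟩
          4 + 2 * (t * n)      ≤⟨ +-monoˡ-≤ (2 * (t * n)) (≤-trans (m≤m+n 4 8) (<⇒≤ 12<n)) ⟩
          n + 2 * (t * n)      ≡⟨ cong (n +_) (*-assoc 2 t n) ⟨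
          suc (2 * t) * n      ≤⟨ *-monoˡ-≤ n 2t<d ⟩
          d * n                ≡⟨ *-comm d n ⟩
          n * d                ∎)
        (≤-trans (s≤s z≤n) 2≤r) 2r<n (≤-trans (s≤s z≤n) 12<d)

  general-lower : ∀ k → IsChromatic H k → 3 ≤ k → ∀ {E} → IsER H E → 2 ^ n ≤ E ^ 12
  general-lower k chromatic 3≤k {E} er = begin
    2 ^ n             ≤⟨ ^-monoʳ-≤ 2 n≤4r ⟩
    2 ^ (r * 4)       ≡⟨ ^-*-assoc 2 r 4 ⟨
    (2 ^ r) ^ 4       ≤⟨ ^-monoˡ-≤ 4 (<⇒≤ (IsER-lower H er not-arrows)) ⟩
    -- The exponent 4 would do; 12 matches the bipartite bound, since both cases share their
    -- constants.
    E ^ 4             ≤⟨ ^-monoʳ-≤ E {{>-nonZero (≤-trans 0<n (size≤ER H er))}} (m≤m+n 4 8) ⟩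
    E ^ 12            ∎
    where
    3≤n = ≤-trans 3≤k (chromatic≤size H chromatic)
    0<n = ≤-trans (s≤s z≤n) 3≤n
    half-n = halve n 0<n
    r = proj₁ half-n
    n≤2+2r = proj₂ (proj₂ half-n)
    0<r : 0 < r
    0<r = ≤-pred (*-cancelˡ-< 2 1 (suc r) (<-≤-trans 3≤n n≤2+2r))
    n≤4r : n ≤ r * 4
    n≤4r = begin
      n              ≤⟨ n≤2+2r ⟩
      2 * suc r      ≤⟨ *-monoʳ-≤ 2 (+-monoˡ-≤ r 0<r) ⟩
      2 * (r + r)    ≡⟨ cong (λ z → 2 * (r + z)) (+-identityʳ r) ⟨
      2 * (2 * r)    ≡⟨ *-assoc 2 2 r ⟨
      4 * r          ≡⟨ *-comm 4 r ⟩
      r * 4          ∎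
    not-arrows : ¬ Arrows (2 ^ r) H
    not-arrows = binary-lower-bound H regular (chromatic⇒degree>0 H regular chromatic (<⇒≤ 3≤k)) r (proj₁ (proj₂ half-n)) (proj₂ chromatic 2 3≤k)

theorem1p2 : ∃ λ a → ∃ λ b → ∃ λ A → ∃ λ B →
    NonZero a × NonZero b × NonZero B × a * B < A * b ×
    (∀ n d (H : Graph n) → Regular H d →
    (IsChromatic H 2 →
    ∃ λ E → IsER H E × n ^ (a * d) ≤ E ^ b × E ^ B ≤ n ^ (A * d)) ×
    (∀ k → IsChromatic H k → 3 ≤ k →
    ∃ λ E → IsER H E × 2 ^ (a * n) ≤ E ^ b × E ^ B ≤ n ^ (A * d * k * n)))
-- The constants are c = 1/12 and C = 23/1; fractional exponents are cleared by raising `E` to the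
-- denominators.
theorem1p2 = 1 , 12 , 23 , 1 , _ , _ , _ , s≤s (s≤s z≤n) , λ n d H regular →
  (λ chromatic → let E , er , E≤ = bipartite-upper H regular chromatic in
    E , er ,
    subst (λ z → n ^ z ≤ E ^ 12) (sym (*-identityˡ d)) (bipartite-lower H regular chromatic er) ,
    ≤-trans (≤-reflexive (*-identityʳ E)) E≤) ,
  (λ k chromatic 3≤k → let E , er , E≤ = general-upper H regular k chromatic 3≤k in
    E , er ,
    subst (λ z → 2 ^ z ≤ E ^ 12) (sym (*-identityˡ n)) (general-lower H regular k chromatic 3≤k er) ,
    ≤-trans (≤-reflexive (*-identityʳ E)) E≤)
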